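{- Let $R$ and $B$ be disjoint finite sets of points in the plane such that no three points of $R\cup B$ are collinear, and let $f:R\to\{2,3,4,\ldots\}$ be a function. If $2\le |B|\le \sum_{x\in R}(f(x)-2)+2$, then there exists a non-crossing geometric spanning tree $T$ on $R\cup B$ such that the set of leaves of $T$ is exactly $B$ and $2\le \deg_T(x)\le f(x)$ for every $x\in R$. Moreover, if $|B|=\sum_{x\in R}(f(x)-2)+2$, then $T$ satisfies $\deg_T(x)=f(x)$ for every $x\in R$.
   Context: The points of $R$ are called red and those of $B$ blue. A geometric spanning tree on a point set $P$ is a tree with vertex set $P$ whose edges are drawn as straight-line segments between their endpoints; it is non-crossing if no two edges intersect except at a common endpoint. $\deg_T(v)$ denotes the degree of vertex $v$ in $T$, and a leaf is a vertex of degree one. -}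

module Defs where

open import Algebra.Apartness.Bundles using (HeytingField; HeytingCommutativeRing)
open import Algebra.Bundles using (CommutativeRing)
import Algebra.Definitions.RawMonoid as Multiple
open import Data.Bool using (Bool; T)
open import Data.Fin using (Fin; zero; suc; inject₁; fromℕ)
open import Data.Fin.Subset using (∣_∣)
open import Data.Nat as ℕ using (ℕ)
open import Data.Product using (_×_; _,_; Σ-syntax; ∃-syntax)
open import Data.Sum using (_⊎_)
open import Data.Vec using (tabulate)
open import Function.Definitions using (Injective)
open import Level using (Level; _⊔_) renaming (suc to lsuc)
open import Relation.Binary.Core using (Rel)
open import Relation.Binary.Construct.Closure.ReflexiveTransitive using (Star)
open import Relation.Binary.PropositionalEquality using (_≡_; _≢_)
open import Relation.Binary.Structures using (IsStrictPartialOrder)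
open import Relation.Nullary using (¬_)

-- The real numbers, axiomatised as an Archimedean, Cauchy-complete ordered
-- field; classically ℝ is the only model up to isomorphism.  The order is not
-- assumed decidable, so that constructive Cauchy reals are a model as well:
-- x # y is positive inequality (x < y or y < x), classically just x ≉ y.
record RealNumbers (c ℓ₁ ℓ₂ ℓ₃ : Level) : Set (lsuc (c ⊔ ℓ₁ ⊔ ℓ₂ ⊔ ℓ₃)) where
  infix 4 _<_ _≤_
  field
    heytingField : HeytingField c ℓ₁ ℓ₂

  open HeytingField heytingField public

  commutativeRing : CommutativeRing c ℓ₁
  commutativeRing = HeytingCommutativeRing.commutativeRing heytingCommutativeRing

  open Multiple (CommutativeRing.+-rawMonoid commutativeRing) public
    using () renaming (_×_ to _·_)

  field
    _<_                  : Rel Carrier ℓ₃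
    isStrictPartialOrder : IsStrictPartialOrder _≈_ _<_
    <⇒#                  : ∀ {x y} → x < y → x # y
    #⇒<⊎>                : ∀ {x y} → x # y → x < y ⊎ y < x
    +-monoˡ-<            : ∀ {x y} z → x < y → x + z < y + z
    *-positive           : ∀ {x y} → 0# < x → 0# < y → 0# < x * y
    archimedean          : ∀ x → ∃[ n ] x < n · 1#

  IsCauchy : (ℕ → Carrier) → Set (c ⊔ ℓ₃)
  IsCauchy s = ∀ ε → 0# < ε →
    ∃[ N ] (∀ m n → N ℕ.≤ m → N ℕ.≤ n → s m < s n + ε)

  _ConvergesTo_ : (ℕ → Carrier) → Carrier → Set (c ⊔ ℓ₃)
  s ConvergesTo l = ∀ ε → 0# < ε →
    ∃[ N ] (∀ n → N ℕ.≤ n → s n < l + ε × l < s n + ε)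

  field
    complete : ∀ s → IsCauchy s → ∃[ l ] s ConvergesTo l

  _≤_ : Rel Carrier ℓ₃
  x ≤ y = ¬ (y < x)

record Graph (n : ℕ) : Set where
  field
    adjacent : Fin n → Fin n → Bool

  Edge : Fin n → Fin n → Set
  Edge u v = T (adjacent u v)

  field
    symmetric   : ∀ {u v} → Edge u v → Edge v u
    irreflexive : ∀ {v} → ¬ Edge v v

  degree : Fin n → ℕ
  degree v = ∣ tabulate (adjacent v) ∣

  Leaf : Fin n → Set
  Leaf v = degree v ≡ 1

  Connected : Set
  Connected = ∀ u v → Star Edge u v

  -- A cycle of length 3 + m, given by its vertices in order.
  Cycle : Set
  Cycle = ∃[ m ] Σ[ w ∈ (Fin (3 ℕ.+ m) → Fin n) ]
    Injective _≡_ _≡_ w ×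
    (∀ (i : Fin (2 ℕ.+ m)) → Edge (w (inject₁ i)) (w (suc i))) ×
    Edge (w (fromℕ (2 ℕ.+ m))) (w zero)

  IsTree : Set
  IsTree = Connected × ¬ Cycle

module Plane {c ℓ₁ ℓ₂ ℓ₃ : Level} (ℝ : RealNumbers c ℓ₁ ℓ₂ ℓ₃) where
  open RealNumbers ℝ

  infix 4 _≈ₚ_

  Point : Set c
  Point = Carrier × Carrier

  _≈ₚ_ : Rel Point ℓ₁
  (x₁ , y₁) ≈ₚ (x₂ , y₂) = x₁ ≈ x₂ × y₁ ≈ y₂

  -- The line α x + β y + γ = 0.
  record Line : Set (c ⊔ ℓ₂) where
    field
      α β γ         : Carrier
      nondegenerate : α # 0# ⊎ β # 0#

  _LiesOff_ : Point → Line → Set ℓ₂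
  (x , y) LiesOff L = α * x + β * y + γ # 0#
    where open Line L

  -- No line contains all three points, in positive form: every line misses
  -- at least one of them.
  NonCollinear : Point → Point → Point → Set (c ⊔ ℓ₂)
  NonCollinear p q r = ∀ (L : Line) → p LiesOff L ⊎ q LiesOff L ⊎ r LiesOff L

  NoThreeCollinear : {n : ℕ} → (Fin n → Point) → Set (c ⊔ ℓ₂)
  NoThreeCollinear P =
    ∀ i j k → i ≢ j → i ≢ k → j ≢ k → NonCollinear (P i) (P j) (P k)

  -- Membership of a point in the closed segment pq.
  _∈[_,_] : Point → Point → Point → Set (c ⊔ ℓ₁ ⊔ ℓ₃)
  z ∈[ (x₁ , y₁) , (x₂ , y₂) ] = ∃[ t ] (0# ≤ t × t ≤ 1# ×
    z ≈ₚ ((1# - t) * x₁ + t * x₂ , (1# - t) * y₁ + t * y₂))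

  -- The vertex v is drawn at P v; an edge {u , v} occurs in both orientations,
  -- hence the two inequality hypotheses on edges.
  NonCrossing : {n : ℕ} → (Fin n → Point) → Graph n → Set (c ⊔ ℓ₁ ⊔ ℓ₃)
  NonCrossing P G = ∀ a b u v → Edge a b → Edge u v →
    ¬ (a ≡ u × b ≡ v) → ¬ (a ≡ v × b ≡ u) →
    ∀ z → z ∈[ P a , P b ] → z ∈[ P u , P v ] →
    ∃[ w ] ((w ≡ a ⊎ w ≡ b) × (w ≡ u ⊎ w ≡ v) × z ≈ₚ P w)
    where open Graph G

  IsNonCrossingSpanningTree : {n : ℕ} → (Fin n → Point) → Graph n →
    Set (c ⊔ ℓ₁ ⊔ ℓ₃)
  IsNonCrossingSpanningTree P G = Graph.IsTree G × NonCrossing P G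

{-# OPTIONS --safe #-}

-- Lowering f, we may assume |B| = Σ (f x − 2) + 2, and must then realise the
-- degrees d = f on R and d = 1 on B, whose sum is that of a tree.  More generally
-- let p be a vertex of the convex hull with the other points sorted by angle
-- around p, and give each point x the weight 1 − c x, where c x = d x − 1 is its
-- number of children; the weights sum to the number k of children of p.  No
-- weight exceeds 1, so the sequence starts with a block of sum 1, and this block
-- splits as A, q, C with q having as many children as the sums of A and C
-- require (either sum vanishing only for an empty list).  Join p to q.  The line
-- pq separates A from C, so q is a hull vertex of A ∪ {q} and of C ∪ {q}, and
-- recursion from q on A and on C, and from p on the remaining points, gives trees
-- which a line separates except at a common vertex.
--
-- Only signs of orientations of triples are decidable, so a hull vertex is found
-- by adding the points one at a time rather than by comparing coordinates.
module Submission where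

open import Defs
open import Algebra.Bundles using (CommutativeRing)
import Algebra.Properties.CommutativeSemigroup as CommutativeSemigroupProperties
import Algebra.Properties.Ring as RingProperties
import Algebra.Properties.Semiring.Mult.TCOptimised as SemiringMult
import Algebra.Solver.Ring as RingSolver
open import Algebra.Solver.Ring.AlmostCommutativeRing using (_-Raw-AlmostCommutative⟶_; fromCommutativeRing)
open import Data.Bool using (Bool; true; false; T)
open import Data.Empty using (⊥; ⊥-elim)
open import Data.Fin using (Fin; zero; suc; inject₁; fromℕ; splitAt; _↑ˡ_; _↑ʳ_)
open import Data.Fin.Properties using (_≟_; any?; suc-injective; splitAt-↑ˡ; splitAt-↑ʳ; splitAt⁻¹-↑ˡ; splitAt⁻¹-↑ʳ)
open import Data.Fin.Subset using (∣_∣)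
open import Data.Integer as ℤ using (ℤ; _⊖_; _◃_)
import Data.Integer.Properties as ℤ
open import Data.List as List using (List; []; _∷_; [_]; length; map; allFin) renaming (_++_ to _++ᴸ_)
import Data.List.Properties as List
open import Data.List.Membership.Propositional using (_∈_; _∉_)
open import Data.List.Membership.Propositional.Properties using (∈-++⁺ˡ; ∈-++⁺ʳ; ∈-++⁻; ∈-allFin)
open import Data.List.Relation.Binary.Permutation.Propositional as ↭ using (_↭_; ↭-sym; ↭-trans; ↭-refl; prep)
open import Data.List.Relation.Binary.Permutation.Propositional.Properties as ↭ using (All-resp-↭; ∈-resp-↭; ↭-length; ↭-empty-inv; ¬x∷xs↭[])
open import Data.List.Relation.Unary.All as All using (All; []; _∷_)
import Data.List.Relation.Unary.All.Properties as All
open import Data.List.Relation.Unary.AllPairs as AllPairs using (AllPairs; []; _∷_)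
import Data.List.Relation.Unary.AllPairs.Properties as AllPairs
open import Data.List.Relation.Unary.Any as Any using (Any; here; there)
open import Data.List.Relation.Unary.Unique.Propositional using (Unique)
open import Data.List.Relation.Unary.Unique.Propositional.Properties using (allFin⁺)
open import Data.Maybe.Base as Maybe using (Maybe)
open import Data.Nat as ℕ using (ℕ; zero; suc)
open import Data.Nat.ListAction using () renaming (sum to sumᴸ)
open import Data.Nat.ListAction.Properties using (sum-++; sum-↭)
import Data.Nat.Properties as ℕ
open import Data.Nat.Tactic.RingSolver using (solve-∀)
open import Data.Product using (_×_; _,_; Σ-syntax; ∃-syntax; proj₁; proj₂)
open import Data.Sign using (Sign)
open import Data.Sum as Sum using (_⊎_; inj₁; inj₂; [_,_]′)
import Data.Vec as Vec
import Data.Vec.Functional as Vector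
open import Data.Vec.Properties using (tabulate-cong)
open import Function using (_∘_; id)
open import Function.Bundles using (_⇔_; mk⇔)
open import Function.Definitions using (Injective)
open import Level using (Level; _⊔_)
open import Relation.Binary.Construct.Closure.ReflexiveTransitive as Star using (Star; _◅_; _◅◅_)
open import Relation.Binary.Core using (Rel)
open import Relation.Binary.PropositionalEquality as ≡ using (_≡_; _≢_)
import Relation.Binary.Reasoning.Setoid as SetoidReasoning
open import Relation.Binary.Structures using (IsStrictPartialOrder)
open import Relation.Nullary using (¬_; Dec; does; yes; no)
open import Relation.Nullary.Decidable using (dec⇒maybe; dec-true; dec-false; _×-dec_; _⊎-dec_)

-- Ring identities with integer coefficients.

-- The library's ring solver cancels terms only if equality of coefficients is
-- testable, so an abstract commutative ring is solved with coefficients in ℤ.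
module IntegerCoefficients {c ℓ : Level} (K : CommutativeRing c ℓ) where
  open import Data.Integer using (+_; -[1+_])
  open CommutativeRing K hiding (zero)
  open RingProperties ring
  open SemiringMult semiring renaming (_×_ to _·_)
  open CommutativeSemigroupProperties +-commutativeSemigroup using (interchange)
  open SetoidReasoning setoid

  ⟦_⟧ℤ : ℤ → Carrier
  ⟦ + n ⟧ℤ      = n · 1#
  ⟦ -[1+ n ] ⟧ℤ = - (suc n · 1#)

  -- The mixed-sign case to which addition reduces: common successors cancel as `1# - 1#`.
  ⟦⟧-⊖ : ∀ m n → ⟦ m ⊖ n ⟧ℤ ≈ m · 1# - n · 1#
  ⟦⟧-⊖ m zero = sym (trans (+-congˡ -0#≈0#) (+-identityʳ _))
  ⟦⟧-⊖ zero (suc n) = sym (+-identityˡ _)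
  ⟦⟧-⊖ (suc m) (suc n) = begin
    ⟦ suc m ⊖ suc n ⟧ℤ               ≡⟨ ≡.cong ⟦_⟧ℤ (ℤ.[1+m]⊖[1+n]≡m⊖n m n) ⟩
    ⟦ m ⊖ n ⟧ℤ                       ≈⟨ ⟦⟧-⊖ m n ⟩
    m · 1# - n · 1#                  ≈⟨ +-identityˡ _ ⟨
    0# + (m · 1# - n · 1#)           ≈⟨ +-congʳ (-‿inverseʳ 1#) ⟨
    (1# - 1#) + (m · 1# - n · 1#)    ≈⟨ interchange _ _ _ _ ⟩
    1# + m · 1# + (- 1# - n · 1#)    ≈⟨ +-cong (sym (1+× m 1#)) (-‿+-comm 1# _) ⟩
    suc m · 1# - (1# + n · 1#)       ≈⟨ +-congˡ (-‿cong (1+× n 1#)) ⟨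
    suc m · 1# - suc n · 1#          ∎

  ⟦⟧-+ : ∀ i j → ⟦ i ℤ.+ j ⟧ℤ ≈ ⟦ i ⟧ℤ + ⟦ j ⟧ℤ
  ⟦⟧-+ (+ m)    (+ n)    = ×-homo-+ 1# m n
  ⟦⟧-+ (+ m)    -[1+ n ] = ⟦⟧-⊖ m (suc n)
  ⟦⟧-+ -[1+ m ] (+ n)    = trans (⟦⟧-⊖ n (suc m)) (+-comm _ _)
  ⟦⟧-+ -[1+ m ] -[1+ n ] = begin
    - (suc (suc (m ℕ.+ n)) · 1#)     ≡⟨ ≡.cong (λ k → - (suc k · 1#)) (ℕ.+-suc m n) ⟨
    - ((suc m ℕ.+ suc n) · 1#)       ≈⟨ -‿cong (×-homo-+ 1# (suc m) (suc n)) ⟩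
    - (suc m · 1# + suc n · 1#)      ≈⟨ -‿+-comm _ _ ⟨
    - (suc m · 1#) - (suc n · 1#)    ∎

  ⟦⟧-neg : ∀ i → ⟦ ℤ.- i ⟧ℤ ≈ - ⟦ i ⟧ℤ
  ⟦⟧-neg (+ zero)  = sym -0#≈0#
  ⟦⟧-neg (+ suc n) = refl
  ⟦⟧-neg -[1+ n ]  = sym (-‿involutive _)

  ⟦⟧-+◃ : ∀ n → ⟦ Sign.+ ◃ n ⟧ℤ ≈ n · 1#
  ⟦⟧-+◃ n = reflexive (≡.cong ⟦_⟧ℤ (ℤ.+◃n≡+n n))

  ⟦⟧--◃ : ∀ n → ⟦ Sign.- ◃ n ⟧ℤ ≈ - (n · 1#)
  ⟦⟧--◃ n = trans (reflexive (≡.cong ⟦_⟧ℤ (ℤ.-◃n≡-n n))) (⟦⟧-neg (+ n))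

  ⟦⟧-* : ∀ i j → ⟦ i ℤ.* j ⟧ℤ ≈ ⟦ i ⟧ℤ * ⟦ j ⟧ℤ
  ⟦⟧-* (+ m)    (+ n)    = trans (⟦⟧-+◃ (m ℕ.* n)) (×1-homo-* m n)
  ⟦⟧-* (+ m)    -[1+ n ] = trans (⟦⟧--◃ (m ℕ.* suc n))
    (trans (-‿cong (×1-homo-* m (suc n))) (-‿distribʳ-* _ _))
  ⟦⟧-* -[1+ m ] (+ n)    = trans (⟦⟧--◃ (suc m ℕ.* n))
    (trans (-‿cong (×1-homo-* (suc m) n)) (-‿distribˡ-* _ _))
  ⟦⟧-* -[1+ m ] -[1+ n ] = begin
    (suc m ℕ.* suc n) · 1#           ≈⟨ ×1-homo-* (suc m) (suc n) ⟩
    suc m · 1# * (suc n · 1#)        ≈⟨ -‿involutive _ ⟨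
    - - (suc m · 1# * (suc n · 1#))  ≈⟨ -‿cong (-‿distribʳ-* _ _) ⟩
    - (suc m · 1# * - (suc n · 1#))  ≈⟨ -‿distribˡ-* _ _ ⟩
    - (suc m · 1#) * - (suc n · 1#)  ∎

  morphism : ℤ.+-*-rawRing -Raw-AlmostCommutative⟶ fromCommutativeRing K
  morphism = record
    { ⟦_⟧    = ⟦_⟧ℤ
    ; +-homo = ⟦⟧-+
    ; *-homo = ⟦⟧-*
    ; -‿homo = ⟦⟧-neg
    ; 0-homo = refl
    ; 1-homo = refl
    }

  _coefficient≟_ : ∀ i j → Maybe (⟦ i ⟧ℤ ≈ ⟦ j ⟧ℤ)
  i coefficient≟ j = Maybe.map (λ eq → reflexive (≡.cong ⟦_⟧ℤ eq)) (dec⇒maybe (i ℤ.≟ j))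

  open RingSolver ℤ.+-*-rawRing (fromCommutativeRing K) morphism
    _coefficient≟_ public
    using (solve; _:=_; _:+_; _:*_; _:-_; :-_; con; Polynomial)

-- Trees grown by attaching leaves, and their degrees.

module Counting where
  open ≡ using (refl; sym; trans; cong; subst)
  open import Data.Nat using (_+_)

  count : ∀ {n} → (Fin n → Bool) → ℕ
  count f = ∣ Vec.tabulate f ∣

  -- A new leaf edge flips one entry in each of two adjacency rows; this is its effect on a row.
  count-insert : ∀ {n} {f g : Fin n → Bool} i → f i ≡ false → g i ≡ true →
    (∀ j → j ≢ i → g j ≡ f j) → count g ≡ suc (count f)
  count-insert {f = f} {g} zero fi gi same rewrite fi | gi =
    cong (suc ∘ ∣_∣) (tabulate-cong (λ j → same (suc j) λ ()))
  count-insert {f = f} {g} (suc i) fi gi same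
    with f zero | g zero | same zero (λ ())
       | count-insert {f = f ∘ suc} {g ∘ suc} i fi gi (λ j j≢i → same (suc j) (j≢i ∘ suc-injective))
  ... | true  | .true  | refl | ih = cong suc ih
  ... | false | .false | refl | ih = ih

module RootedTrees {n : ℕ} where
  open ≡ using (refl; sym; trans; cong; subst)
  open import Data.Nat using (_+_)
  open Counting

  V : Set
  V = Fin n

  children : List (V × V) → List V
  children = map proj₁

  -- Edges are pairs (child , parent); the list is read from right to left.
  data Grown (root : V) : List (V × V) → Set where
    bare : Grown root []
    leaf : ∀ {c p es} → p ∈ root ∷ children es → c ∉ root ∷ children es →
      Grown root es → Grown root ((c , p) ∷ es)

  Joins : V × V → V → V → Set
  Joins (c , p) u v = (u ≡ c × v ≡ p) ⊎ (u ≡ p × v ≡ c)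

  joins? : ∀ e u v → Dec (Joins e u v)
  joins? (c , p) u v = ((u ≟ c) ×-dec (v ≟ p)) ⊎-dec ((u ≟ p) ×-dec (v ≟ c))

  joins-sym : ∀ e {u v} → Joins e u v → Joins e v u
  joins-sym e (inj₁ (u≡c , v≡p)) = inj₂ (v≡p , u≡c)
  joins-sym e (inj₂ (u≡p , v≡c)) = inj₁ (v≡c , u≡p)

  Adjacent : List (V × V) → V → V → Set
  Adjacent es u v = Any (λ e → Joins e u v) es

  adjacent? : ∀ es u v → Dec (Adjacent es u v)
  adjacent? es u v = Any.any? (λ e → joins? e u v) es

  adjacent-sym : ∀ {es u v} → Adjacent es u v → Adjacent es v u
  adjacent-sym = Any.map (λ {e} → joins-sym e)

  -- The edges of `fs` are attached after those of `es`: their children stay fresh by disjointness,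
  -- and their root `q` is already present.
  ++-grown : ∀ {root q es fs} → Grown root es → q ∈ root ∷ children es → Grown q fs →
    (∀ {v} → v ∈ children fs → v ∉ root ∷ children es) → Grown root (fs ++ᴸ es)
  ++-grown g q∈ bare disjoint = g
  ++-grown {root} {q} {es} g q∈ (leaf {c} {p} {fs} p∈ c∉ h) disjoint =
    leaf (parent p∈) child (++-grown g q∈ h (disjoint ∘ there))
    where
    children-++ : children (fs ++ᴸ es) ≡ children fs ++ᴸ children es
    children-++ = List.map-++ proj₁ fs es

    weaken : ∀ {v} → v ∈ root ∷ children es → v ∈ root ∷ children (fs ++ᴸ es)
    weaken (here v≡) = here v≡
    weaken (there v∈) = there (subst (_ ∈_) (sym children-++) (∈-++⁺ʳ (children fs) v∈))

    parent : p ∈ q ∷ children fs → p ∈ root ∷ children (fs ++ᴸ es)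
    parent (here refl) = weaken q∈
    parent (there p∈fs) = there (subst (p ∈_) (sym children-++) (∈-++⁺ˡ p∈fs))

    child : c ∉ root ∷ children (fs ++ᴸ es)
    child (here c≡root) = disjoint (here refl) (here c≡root)
    child (there c∈) with ∈-++⁻ (children fs) (subst (c ∈_) children-++ c∈)
    ... | inj₁ c∈fs = c∉ (there c∈fs)
    ... | inj₂ c∈es = disjoint (here refl) (there c∈es)

  edge-proper : ∀ {root es} → Grown root es → All (λ e → proj₁ e ≢ proj₂ e) es
  edge-proper bare = []
  edge-proper (leaf p∈ c∉ g) = (λ { refl → c∉ p∈ }) ∷ edge-proper g

  edge-inside : ∀ {root es} → Grown root es →
    All (λ e → proj₁ e ∈ root ∷ children es × proj₂ e ∈ root ∷ children es) es
  edge-inside bare = []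
  edge-inside (leaf p∈ c∉ g) =
    (there (here refl) , skip p∈) ∷ All.map (λ (c∈ , p∈) → skip c∈ , skip p∈) (edge-inside g)
    where
    skip : ∀ {v x y : V} {zs} → v ∈ x ∷ zs → v ∈ x ∷ y ∷ zs
    skip (here v≡) = here v≡
    skip (there v∈) = there (there v∈)

  adjacent-inside : ∀ {root es u v} → Grown root es → Adjacent es u v → u ∈ root ∷ children es
  adjacent-inside g a with All.lookupAny (edge-inside g) a
  ... | (c∈ , p∈) , inj₁ (u≡c , _) = subst (_∈ _) (sym u≡c) c∈
  ... | (c∈ , p∈) , inj₂ (u≡p , _) = subst (_∈ _) (sym u≡p) p∈

  -- A vertex outside the old tree lies on no old edge, so only the head of the list can supply a
  -- neighbour.
  only-neighbour : ∀ {root c p es v} → Grown root es → c ∉ root ∷ children es →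
    Adjacent ((c , p) ∷ es) c v → v ≡ p
  only-neighbour g c∉ (here (inj₁ (_ , v≡p))) = v≡p
  only-neighbour g c∉ (here (inj₂ (c≡p , v≡c))) = trans v≡c c≡p
  only-neighbour g c∉ (there a) = ⊥-elim (c∉ (adjacent-inside g a))

  -- A finite set in which every vertex has two neighbours cannot contain the
  -- last leaf that was attached, hence already lives in the smaller tree.
  no-core : ∀ {root es k} → Grown root es → (w : Fin (suc k) → V) →
    (∀ i → ∃[ j ] ∃[ j′ ] (w j ≢ w j′ × Adjacent es (w i) (w j) × Adjacent es (w i) (w j′))) → ⊥
  no-core bare w two with two zero
  ... | _ , _ , _ , () , _
  no-core (leaf {c} {p} {es} p∈ c∉ g) w two with any? (λ i → w i ≟ c)
  ... | yes (i , refl) = let j , j′ , j≢j′ , a , a′ = two i in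
    j≢j′ (trans (only-neighbour g c∉ a) (sym (only-neighbour g c∉ a′)))
  ... | no avoids = no-core g w (λ i →
      let j , j′ , j≢j′ , a , a′ = two i in j , j′ , j≢j′ , old i j a , old i j′ a′)
    where
    old : ∀ i j → Adjacent ((c , p) ∷ es) (w i) (w j) → Adjacent es (w i) (w j)
    old i j (here (inj₁ (wi≡c , _))) = ⊥-elim (avoids (i , wi≡c))
    old i j (here (inj₂ (_ , wj≡c))) = ⊥-elim (avoids (j , wj≡c))
    old i j (there a) = a

  does⇒ : ∀ {A : Set} (a? : Dec A) → T (does a?) → A
  does⇒ (yes a) _ = a

  ⇒does : ∀ {A : Set} (a? : Dec A) → A → T (does a?)
  ⇒does (yes _) _ = _
  ⇒does (no ¬a) a = ¬a a

  graph : ∀ {root es} → Grown root es → Graph n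
  graph {es = es} g = record
    { adjacent    = λ u v → does (adjacent? es u v)
    ; symmetric   = λ {u} {v} → ⇒does (adjacent? es v u) ∘ adjacent-sym ∘ does⇒ (adjacent? es u v)
    ; irreflexive = λ {v} → loopless ∘ does⇒ (adjacent? es v v)
    }
    where
    loopless : ∀ {v} → ¬ Adjacent es v v
    loopless a with All.lookupAny (edge-proper g) a
    ... | c≢p , inj₁ (v≡c , v≡p) = c≢p (trans (sym v≡c) v≡p)
    ... | c≢p , inj₂ (v≡p , v≡c) = c≢p (trans (sym v≡c) v≡p)

  reach : ∀ {root es} → Grown root es → ∀ {v} → v ∈ root ∷ children es → Star (Adjacent es) root v
  reach g (here refl) = Star.ε
  reach (leaf p∈ c∉ g) (there (here refl)) =
    Star.map there (reach g p∈) ◅◅ (here (inj₂ (refl , refl)) ◅ Star.ε)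
  reach (leaf p∈ c∉ g) (there (there v∈)) = Star.map there (reach g (there v∈))

  -- Prepares a cycle for `no-core`: predecessor and successor are two neighbours, distinct because
  -- the length is at least 3 and `w` is injective.
  cycle-neighbours : ∀ m {E : V → V → Set} (w : Fin (3 + m) → V) → (∀ {u v} → E u v → E v u) →
    Injective _≡_ _≡_ w →
    (∀ (i : Fin (2 + m)) → E (w (inject₁ i)) (w (suc i))) → E (w (fromℕ (2 + m))) (w zero) →
    ∀ i → ∃[ j ] ∃[ j′ ] (w j ≢ w j′ × E (w i) (w j) × E (w i) (w j′))
  cycle-neighbours m w E-sym inj path close zero =
    suc zero , fromℕ (2 + m) , (λ eq → one≢last (inj eq)) , path zero , E-sym close
    where
    one≢last : suc zero ≢ fromℕ (2 + m)
    one≢last ()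
  cycle-neighbours m {E} w E-sym inj path close (suc i) with next i
    where
    -- Either `suc i` is the last vertex, followed by `zero`, or path edge `j` leaves it and ends
    -- away from the predecessor.
    next : ∀ {k} (i : Fin (suc k)) → i ≡ fromℕ k ⊎ ∃[ j ] (suc i ≡ inject₁ j × suc j ≢ inject₁ i)
    next {zero} zero = inj₁ refl
    next {suc k} zero = inj₂ (suc zero , refl , λ ())
    next {suc k} (suc i) with next i
    ... | inj₁ eq = inj₁ (cong suc eq)
    ... | inj₂ (j , eq , neq) = inj₂ (suc j , cong suc eq , neq ∘ suc-injective)
  ... | inj₁ refl = inject₁ (fromℕ (suc m)) , zero , (λ eq → nonzero (inj eq)) , E-sym (path (fromℕ (suc m))) , close
    where
    nonzero : inject₁ (fromℕ (suc m)) ≢ zero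
    nonzero ()
  ... | inj₂ (j , eq , neq) = inject₁ i , suc j , (λ eq′ → neq (sym (inj eq′))) ,
    E-sym (path i) , subst (λ x → E (w x) (w (suc j))) (sym eq) (path j)

  -- Any two vertices are linked through the root, and a cycle would contradict `no-core`.
  graph-tree : ∀ {root es} (g : Grown root es) → (∀ v → v ∈ root ∷ children es) →
    Graph.IsTree (graph g)
  graph-tree {es = es} g spans =
    (λ u v → Star.map (λ {u} {v} → ⇒does (adjacent? es u v))
      (Star.reverse adjacent-sym (reach g (spans u)) ◅◅ reach g (spans v))) ,
    λ (m , w , inj , path , close) → no-core g w (cycle-neighbours m {Adjacent es} w adjacent-sym inj
      (λ i → does⇒ (adjacent? es _ _) (path i)) (does⇒ (adjacent? es _ _) close))

  δ : V → V → ℕ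
  δ x v with x ≟ v
  ... | yes _ = 1
  ... | no _  = 0

  δ-refl : ∀ v → δ v v ≡ 1
  δ-refl v with v ≟ v
  ... | yes _ = refl
  ... | no v≢v = ⊥-elim (v≢v refl)

  δ-≢ : ∀ {x v} → x ≢ v → δ x v ≡ 0
  δ-≢ {x} {v} x≢v with x ≟ v
  ... | yes x≡v = ⊥-elim (x≢v x≡v)
  ... | no _ = refl

  -- A degree additive under concatenation of edge lists. It agrees with the degree in the graph
  -- because a grown list has neither loops nor repeated edges.
  valence : List (V × V) → V → ℕ
  valence es v = sumᴸ (map (λ e → δ (proj₁ e) v + δ (proj₂ e) v) es)

  -- Since `c` is fresh, the new edge was absent in both directions; only the rows of `c` and `p`
  -- change, by one entry each.
  graph-degree : ∀ {root es} (g : Grown root es) v → Graph.degree (graph g) v ≡ valence es v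
  graph-degree bare v = none n
    where
    none : ∀ m → count {m} (λ _ → false) ≡ 0
    none zero = refl
    none (suc m) = none m
  graph-degree {es = (c , p) ∷ es} (leaf p∈ c∉ g) v =
    trans (step (v ≟ c) (v ≟ p)) (cong (δ c v + δ p v +_) (graph-degree g v))
    where
    row row′ : V → V → Bool
    row u x = does (adjacent? es u x)
    row′ u x = does (adjacent? ((c , p) ∷ es) u x)

    p≢c : p ≢ c
    p≢c refl = c∉ p∈

    new : ∀ {u x} → Joins (c , p) u x → row′ u x ≡ true
    new {u} {x} j = dec-true (adjacent? ((c , p) ∷ es) u x) (here j)

    old : ∀ {u x} → ¬ Joins (c , p) u x → row′ u x ≡ row u x
    old {u} {x} ¬j rewrite dec-false (joins? (c , p) u x) ¬j = refl

    fresh : ∀ {u x} → u ≡ c ⊎ x ≡ c → row u x ≡ false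
    fresh {u} {x} (inj₁ refl) = dec-false (adjacent? es u x) (λ a → c∉ (adjacent-inside g a))
    fresh {u} {x} (inj₂ refl) =
      dec-false (adjacent? es u x) (λ a → c∉ (adjacent-inside g (adjacent-sym a)))

    step : Dec (v ≡ c) → Dec (v ≡ p) → count (row′ v) ≡ δ c v + δ p v + count (row v)
    step (yes refl) _ rewrite δ-refl v | δ-≢ p≢c =
      count-insert p (fresh (inj₁ refl)) (new (inj₁ (refl , refl)))
        (λ x x≢p → old [ (λ (_ , x≡p) → x≢p x≡p) , (λ (c≡p , _) → p≢c (sym c≡p)) ]′)
    step (no v≢c) (yes refl) rewrite δ-refl v | δ-≢ (v≢c ∘ sym) =
      count-insert c (fresh (inj₂ refl)) (new (inj₂ (refl , refl)))
        (λ x x≢c → old [ (λ (p≡c , _) → p≢c p≡c) , (λ (_ , x≡c) → x≢c x≡c) ]′)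
    step (no v≢c) (no v≢p) rewrite δ-≢ (v≢c ∘ sym) | δ-≢ (v≢p ∘ sym) =
      cong ∣_∣ (tabulate-cong {f = row′ v} {g = row v} (λ x → old [ v≢c ∘ proj₁ , v≢p ∘ proj₁ ]′))

-- Splitting balanced sequences of weights.

-- c x is the number of children of x, so the descendants of a vertex with k
-- children satisfy Σ (1 − c x) = k; Balanced states this without subtraction.
module Balance {A : Set} (c : A → ℕ) where
  open ≡ using (refl; sym; trans; cong; subst)
  open import Data.Nat using (_+_; _≤?_)

  load : List A → ℕ
  load xs = sumᴸ (map c xs)

  load-++ : ∀ xs ys → load (xs ++ᴸ ys) ≡ load xs + load ys
  load-++ xs ys = trans (cong sumᴸ (List.map-++ c xs ys)) (sum-++ (map c xs) (map c ys))

  -- The second condition does not follow from the sum: a vertex with one child has weight 0, so a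
  -- nonempty list can sum to zero, but a childless vertex has no descendants.
  Balanced : ℕ → List A → Set
  Balanced k xs = load xs + k ≡ length xs × (k ≡ 0 → xs ≡ [])

  -- Cuts off a prefix of weight `i`. No weight exceeds 1, so the missing amount falls by at most
  -- one per element and cannot jump over 0; the equation keeps the list from ending earlier.
  split : ∀ i k xs → load xs + (i + k) ≡ length xs →
    ∃[ ys ] ∃[ zs ] (xs ≡ ys ++ᴸ zs × load ys + i ≡ length ys × load zs + k ≡ length zs)
  split zero k xs eq = [] , xs , refl , refl , eq
  split (suc i) k (x ∷ xs) eq
    with split (c x + i) k xs (ℕ.suc-injective (trans (arith (c x) (load xs) i k) eq))
    where
    arith : ∀ a l i k → suc (l + (a + i + k)) ≡ a + l + (suc i + k)
    arith = solve-∀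
  ... | ys , zs , refl , eq₁ , eq₂ =
    x ∷ ys , zs , refl , trans (arith (c x) (load ys) i) (cong suc eq₁) , eq₂
    where
    arith : ∀ a l i → a + l + suc i ≡ suc (l + (a + i))
    arith = solve-∀

  split-off : ∀ k xs → Balanced (suc k) xs →
    ∃[ ys ] ∃[ zs ] (xs ≡ ys ++ᴸ zs × Balanced 1 ys × Balanced k zs)
  -- The whole list is the block here: the first prefix of weight 1 could leave a nonempty rest of
  -- weight 0.
  split-off zero xs (eq , _) =
    xs , [] , sym (List.++-identityʳ xs) , (eq , λ ()) , refl , λ _ → refl
  split-off (suc k) xs (eq , _) with split 1 (suc k) xs eq
  ... | ys , zs , xs≡ , eq₁ , eq₂ = ys , zs , xs≡ , (eq₁ , λ ()) , eq₂ , λ ()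

  -- The block has total weight 1 and `j` is the weight of the prefix `ys`, so cutting at `x` gives
  -- `c x = j + k` with `k` the weight of what follows. The search stops at the first `x` with
  -- `c x > j`, where `k` is positive, or at the last element, where `k = 0` and nothing follows.
  scan : ∀ ys j x zs → Balanced j ys → load (x ∷ zs) + 1 ≡ length (x ∷ zs) + j →
    ∃[ as ] ∃[ q ] ∃[ cs ] ∃[ i ] ∃[ k ] (ys ++ᴸ x ∷ zs ≡ as ++ᴸ q ∷ cs ×
      Balanced i as × Balanced k cs × c q ≡ i + k)
  scan ys j x [] bal eq =
    ys , x , [] , j , 0 , refl , bal , (refl , λ _ → refl) ,
    ℕ.suc-injective (trans (arith (c x)) (trans eq (cong suc (sym (ℕ.+-identityʳ j)))))
    where
    arith : ∀ a → suc a ≡ a + 0 + 1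
    arith = solve-∀
  scan ys j x (z ∷ zs) bal@(ys-eq , _) eq with c x ≤? j
  ... | no cx≰j with ℕ.m≤n⇒∃[o]m+o≡n (ℕ.≰⇒> cx≰j)
  ...   | k , j+k≡cx = ys , x , z ∷ zs , j , suc k , refl , bal ,
        (ℕ.+-cancelʳ-≡ (suc j) _ _
          (trans (arith (load (z ∷ zs)) k j)
            (trans (cong (λ a → a + load (z ∷ zs) + 1) j+k≡cx)
              (trans eq (sym (ℕ.+-suc (length (z ∷ zs)) j))))) , λ ()) ,
        trans (sym j+k≡cx) (sym (ℕ.+-suc j k))
    where
    arith : ∀ l k j → l + suc k + suc j ≡ suc j + k + l + 1
    arith = solve-∀
  -- Passing `x` turns the prefix weight `c x + e` into `suc e`, which is positive, so the longer
  -- prefix is balanced.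
  scan ys j x (z ∷ zs) (ys-eq , _) eq | yes cx≤j with ℕ.m≤n⇒∃[o]m+o≡n cx≤j
  ... | e , refl with scan (ys ++ᴸ [ x ]) (suc e) z zs (extended , λ ()) remaining
    where
    extended : load (ys ++ᴸ [ x ]) + suc e ≡ length (ys ++ᴸ [ x ])
    extended = trans (cong (_+ suc e) (load-++ ys [ x ]))
      (trans (arith (load ys) (c x) e)
        (trans (cong (_+ 1) ys-eq) (sym (List.length-++ ys))))
      where
      arith : ∀ l a e → l + (a + 0) + suc e ≡ l + (a + e) + 1
      arith = solve-∀

    remaining : load (z ∷ zs) + 1 ≡ length (z ∷ zs) + suc e
    remaining = ℕ.+-cancelˡ-≡ (c x) _ _
      (trans (sym (ℕ.+-assoc (c x) (load (z ∷ zs)) 1))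
        (trans eq (arith (length (z ∷ zs)) (c x) e)))
      where
      arith : ∀ l a e → suc l + (a + e) ≡ a + (l + suc e)
      arith = solve-∀
  ...   | as , q , cs , i , k , eq′ , rest =
    as , q , cs , i , k , trans (sym (List.++-assoc ys [ x ] (z ∷ zs))) eq′ , rest

  decompose : ∀ k xs → Balanced (suc k) xs →
    ∃[ as ] ∃[ q ] ∃[ cs ] ∃[ ds ] ∃[ i ] ∃[ j ] (xs ≡ (as ++ᴸ q ∷ cs) ++ᴸ ds ×
      Balanced i as × Balanced j cs × c q ≡ i + j × Balanced k ds)
  decompose k xs bal with split-off k xs bal
  ... | [] , zs , xs≡ , (() , _) , bal-zs
  ... | y ∷ ys , zs , xs≡ , (eq , _) , bal-zs
      with scan [] 0 y ys (refl , λ _ → refl) (trans eq (sym (ℕ.+-identityʳ _)))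
  ...   | as , q , cs , i , j , eq′ , bal-as , bal-cs , cq =
    as , q , cs , zs , i , j , trans xs≡ (cong (_++ᴸ zs) eq′) , bal-as , bal-cs , cq , bal-zs

-- Sign arguments without a decidable order.

module OrderedField {c ℓ₁ ℓ₂ ℓ₃ : Level} (ℝ : RealNumbers c ℓ₁ ℓ₂ ℓ₃) where
  open import Data.Integer using (+_)
  open RealNumbers ℝ hiding (zero)
  open IntegerCoefficients commutativeRing
  private module < = IsStrictPartialOrder isStrictPartialOrder

  pos-resp : ∀ {x y} → x ≈ y → 0# < x → 0# < y
  pos-resp = <.<-respʳ-≈

  pos-+ : ∀ {x y} → 0# < x → 0# < y → 0# < x + y
  pos-+ {x} {y} 0<x 0<y = <.trans 0<y (<.<-respˡ-≈ (+-identityˡ y) (+-monoˡ-< y 0<x))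

  zero⇒¬pos : ∀ {x} → x ≈ 0# → ¬ 0# < x
  zero⇒¬pos x≈0 0<x = <.irrefl refl (pos-resp x≈0 0<x)

  pos-contra : ∀ {x y} → x + y ≈ 0# → 0# < x → 0# < y → ⊥
  pos-contra eq 0<x 0<y = zero⇒¬pos eq (pos-+ 0<x 0<y)

  <⇒pos : ∀ {x y} → x < y → 0# < y - x
  <⇒pos {x} {y} x<y = <.<-respˡ-≈ (-‿inverseʳ x) (+-monoˡ-< (- x) x<y)

  pos⇒< : ∀ {x y} → 0# < y - x → x < y
  pos⇒< {x} {y} 0<y-x = <.<-respˡ-≈ (+-identityˡ x) (<.<-respʳ-≈
    (solve 2 (λ x y → y :- x :+ x := y) refl x y) (+-monoˡ-< x 0<y-x))

  signed : ∀ {x} → x # 0# → 0# < x ⊎ 0# < - x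
  signed {x} x#0 with #⇒<⊎> x#0
  ... | inj₁ x<0 = inj₂ (pos-resp (+-identityˡ (- x)) (<⇒pos x<0))
  ... | inj₂ 0<x = inj₁ 0<x

  -- Stands in for trichotomy: apartness from 0 would yield a sign, and its absence is equality by
  -- tightness.
  zero-by-sign : ∀ {x} → ¬ 0# < x → ¬ 0# < - x → x ≈ 0#
  zero-by-sign {x} x≤0 x≥0 = proj₁ (tight x 0#) ([ x≤0 , x≥0 ]′ ∘ signed)

  #-respˡ : ∀ {x y z} → x ≈ y → x # z → y # z
  #-respˡ {x} {y} x≈y x#z with #-cotrans x#z y
  ... | inj₁ x#y = ⊥-elim (#-irrefl x≈y x#y)
  ... | inj₂ y#z = y#z

  -- If the sum were negative, `0# < x` would make `y` negative; so `x` is 0, and then `y` is the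
  -- negative sum.
  nonneg-+ : ∀ {x y} → ¬ 0# < - x → ¬ 0# < - y → ¬ 0# < - (x + y)
  nonneg-+ {x} {y} x≥0 y≥0 neg = y≥0 (pos-resp
      (trans (-‿cong (+-congʳ x≈0)) (-‿cong (+-identityˡ y))) neg)
    where
    x≈0 : x ≈ 0#
    x≈0 = zero-by-sign (λ 0<x → y≥0 (pos-resp
      (solve 2 (λ x y → :- (x :+ y) :+ x := :- y) refl x y) (pos-+ neg 0<x))) x≥0

  -- If the product were negative, `0# < x` would force `y`, and with it the product, to be 0. So
  -- `x` is 0, and again the product is 0.
  nonneg-* : ∀ {x y} → ¬ 0# < - x → ¬ 0# < - y → ¬ 0# < - (x * y)
  nonneg-* {x} {y} x≥0 y≥0 neg = zero⇒¬pos
      (trans (-‿cong (*-congʳ x≈0)) (solve 1 (λ y → :- (con (+ 0) :* y) := con (+ 0)) refl y)) neg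
    where
    y≈0 : 0# < x → y ≈ 0#
    y≈0 0<x = zero-by-sign
      (λ 0<y → pos-contra (-‿inverseʳ (x * y)) (*-positive 0<x 0<y) neg) y≥0

    x≈0 : x ≈ 0#
    x≈0 = zero-by-sign (λ 0<x → zero⇒¬pos
      (trans (-‿cong (*-congˡ (y≈0 0<x))) (solve 1 (λ x → :- (x :* con (+ 0)) := con (+ 0)) refl x)) neg) x≥0

  ≤⇒nonneg : ∀ {x y} → x ≤ y → ¬ 0# < - (y - x)
  ≤⇒nonneg {x} {y} x≤y neg = x≤y (pos⇒< (pos-resp
    (solve 2 (λ x y → :- (y :- x) := x :- y) refl x y) neg))

  0≤⇒nonneg : ∀ {x} → 0# ≤ x → ¬ 0# < - x
  0≤⇒nonneg {x} 0≤x 0<-x = 0≤x (pos⇒< (pos-resp (sym (+-identityˡ (- x))) 0<-x))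

  nonneg⇒0≤ : ∀ {x} → ¬ 0# < - x → 0# ≤ x
  nonneg⇒0≤ {x} x≥0 x<0 = x≥0 (pos-resp (+-identityˡ (- x)) (<⇒pos x<0))

-- Orientations, half-planes and segments.

module Vectors {c ℓ₁ ℓ₂ ℓ₃ : Level} (ℝ : RealNumbers c ℓ₁ ℓ₂ ℓ₃) where
  open import Data.Integer using (+_)
  open RealNumbers ℝ hiding (zero)
  open Plane ℝ
  open IntegerCoefficients commutativeRing
  open OrderedField ℝ

  infixl 6 _⊹_ _⊝_
  infix  8 ⊝_

  abstract
    _⊹_ _⊝_ : Point → Point → Point
    (a₁ , a₂) ⊹ (b₁ , b₂) = a₁ + b₁ , a₂ + b₂
    (a₁ , a₂) ⊝ (b₁ , b₂) = a₁ - b₁ , a₂ - b₂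

    ⊝_ : Point → Point
    ⊝ (a₁ , a₂) = - a₁ , - a₂

    cross : Point → Point → Carrier
    cross (a₁ , a₂) (b₁ , b₂) = a₁ * b₂ - a₂ * b₁

  -- Up to a positive factor, the signed distance of z from the line through x
  -- in direction e.
  height : Point → Point → Point → Carrier
  height e x z = cross e (z ⊝ x)

  -- Twice the signed area of the triangle `abc`, positive when it runs counterclockwise.
  side : Point → Point → Point → Carrier
  side a b c = height (b ⊝ a) a c

  private
    Vec₂ : ℕ → Set
    Vec₂ n = Polynomial n × Polynomial n

    infixl 6 _:⊹_ _:⊝_
    _:⊹_ _:⊝_ : ∀ {n} → Vec₂ n → Vec₂ n → Vec₂ n
    (a₁ , a₂) :⊹ (b₁ , b₂) = a₁ :+ b₁ , a₂ :+ b₂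
    (a₁ , a₂) :⊝ (b₁ , b₂) = a₁ :- b₁ , a₂ :- b₂

    :⊝_ : ∀ {n} → Vec₂ n → Vec₂ n
    :⊝ (a₁ , a₂) = :- a₁ , :- a₂

    :cross : ∀ {n} → Vec₂ n → Vec₂ n → Polynomial n
    :cross (a₁ , a₂) (b₁ , b₂) = a₁ :* b₂ :- a₂ :* b₁

    :height : ∀ {n} → Vec₂ n → Vec₂ n → Vec₂ n → Polynomial n
    :height e x z = :cross e (z :⊝ x)

    :side : ∀ {n} → Vec₂ n → Vec₂ n → Vec₂ n → Polynomial n
    :side a b c = :height (b :⊝ a) a c

    :0 : ∀ {n} → Polynomial n
    :0 = con (+ 0)

  abstract
    height-base : ∀ e x → height e x x ≈ 0#
    height-base (e₁ , e₂) (x₁ , x₂) = solve 4 (λ e₁ e₂ x₁ x₂ →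
      :height (e₁ , e₂) (x₁ , x₂) (x₁ , x₂) := :0) refl e₁ e₂ x₁ x₂

    height-⊝ : ∀ e x z → height (⊝ e) x z ≈ - height e x z
    height-⊝ (e₁ , e₂) (x₁ , x₂) (z₁ , z₂) = solve 6 (λ e₁ e₂ x₁ x₂ z₁ z₂ →
      :height (:⊝ (e₁ , e₂)) (x₁ , x₂) (z₁ , z₂) := :- :height (e₁ , e₂) (x₁ , x₂) (z₁ , z₂))
      refl e₁ e₂ x₁ x₂ z₁ z₂

    height-cong : ∀ e x {z z′} → z ≈ₚ z′ → height e x z ≈ height e x z′
    height-cong e x (eq₁ , eq₂) = +-cong (*-congˡ (+-congʳ eq₂)) (-‿cong (*-congˡ (+-congʳ eq₁)))

    height-affine : ∀ e x t a b → height e x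
      ((1# - t) * proj₁ a + t * proj₁ b , (1# - t) * proj₂ a + t * proj₂ b) ≈
      (1# - t) * height e x a + t * height e x b
    height-affine (e₁ , e₂) (x₁ , x₂) t (a₁ , a₂) (b₁ , b₂) =
      solve 9 (λ e₁ e₂ x₁ x₂ t a₁ a₂ b₁ b₂ →
        :height (e₁ , e₂) (x₁ , x₂) ((con (+ 1) :- t) :* a₁ :+ t :* b₁ , (con (+ 1) :- t) :* a₂ :+ t :* b₂) :=
        (con (+ 1) :- t) :* :height (e₁ , e₂) (x₁ , x₂) (a₁ , a₂) :+ t :* :height (e₁ , e₂) (x₁ , x₂) (b₁ , b₂))
        refl e₁ e₂ x₁ x₂ t a₁ a₂ b₁ b₂

    -- Linearity in the direction; such a sum of vectors directs the separating line in `separate`.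
    height-sum : ∀ p y z s → height ((y ⊝ p) ⊹ (z ⊝ p)) p s ≈ side p y s + side p z s
    height-sum (p₁ , p₂) (y₁ , y₂) (z₁ , z₂) (s₁ , s₂) = solve 8 (λ p₁ p₂ y₁ y₂ z₁ z₂ s₁ s₂ →
      let p = p₁ , p₂ ; y = y₁ , y₂ ; z = z₁ , z₂ ; s = s₁ , s₂ in
      :height ((y :⊝ p) :⊹ (z :⊝ p)) p s := :side p y s :+ :side p z s)
      refl p₁ p₂ y₁ y₂ z₁ z₂ s₁ s₂

    -- The three-term Grassmann-Plücker relation, the source of transitivity for the angular order.
    cross-plücker : ∀ e u v w →
      cross e v * cross w u + (cross e u * cross v w + cross e w * cross u v) ≈ 0#
    cross-plücker (e₁ , e₂) (u₁ , u₂) (v₁ , v₂) (w₁ , w₂) = solve 8 (λ e₁ e₂ u₁ u₂ v₁ v₂ w₁ w₂ →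
      let e = e₁ , e₂ ; u = u₁ , u₂ ; v = v₁ , v₂ ; w = w₁ , w₂ in
      :cross e v :* :cross w u :+ (:cross e u :* :cross v w :+ :cross e w :* :cross u v) := :0)
      refl e₁ e₂ u₁ u₂ v₁ v₂ w₁ w₂

    side-swap : ∀ a b c → side a b c ≈ - side a c b
    side-swap (a₁ , a₂) (b₁ , b₂) (c₁ , c₂) = solve 6 (λ a₁ a₂ b₁ b₂ c₁ c₂ →
      let a = a₁ , a₂ ; b = b₁ , b₂ ; c = c₁ , c₂ in :side a b c := :- :side a c b)
      refl a₁ a₂ b₁ b₂ c₁ c₂

    side-diagonal : ∀ a b → side a b b ≈ 0#
    side-diagonal (a₁ , a₂) (b₁ , b₂) = solve 4 (λ a₁ a₂ b₁ b₂ →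
      :side (a₁ , a₂) (b₁ , b₂) (b₁ , b₂) := :0) refl a₁ a₂ b₁ b₂

    height-end : ∀ p q → height (q ⊝ p) q p ≈ 0#
    height-end (p₁ , p₂) (q₁ , q₂) = solve 4 (λ p₁ p₂ q₁ q₂ →
      :height ((q₁ , q₂) :⊝ (p₁ , p₂)) (q₁ , q₂) (p₁ , p₂) := :0) refl p₁ p₂ q₁ q₂

    -- The height over the parallel to `pq` through `x` is the height of `pq` over that parallel
    -- plus the height over `pq`.
    height-rebase : ∀ p q x s → height (q ⊝ p) x s ≈ side p x q + side p q s
    height-rebase (p₁ , p₂) (q₁ , q₂) (x₁ , x₂) (s₁ , s₂) = solve 8 (λ p₁ p₂ q₁ q₂ x₁ x₂ s₁ s₂ →
      let p = p₁ , p₂ ; q = q₁ , q₂ ; x = x₁ , x₂ ; s = s₁ , s₂ in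
      :height (q :⊝ p) x s := :side p x q :+ :side p q s)
      refl p₁ p₂ q₁ q₂ x₁ x₂ s₁ s₂

  segment-sym : ∀ {z a b} → z ∈[ a , b ] → z ∈[ b , a ]
  segment-sym {z} {a₁ , a₂} {b₁ , b₂} (t , 0≤t , t≤1 , eq₁ , eq₂) =
    1# - t ,
    nonneg⇒0≤ (≤⇒nonneg t≤1) ,
    (λ 1<1-t → 0≤⇒nonneg 0≤t (pos-resp
      (solve 1 (λ t → con (+ 1) :- t :- con (+ 1) := :- t) refl t) (<⇒pos 1<1-t))) ,
    trans eq₁ (flip a₁ b₁) , trans eq₂ (flip a₂ b₂)
    where
    flip : ∀ a b → (1# - t) * a + t * b ≈ (1# - (1# - t)) * b + (1# - t) * a
    flip a b = solve 3 (λ t a b → (con (+ 1) :- t) :* a :+ t :* b :=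
      (con (+ 1) :- (con (+ 1) :- t)) :* b :+ (con (+ 1) :- t) :* a) refl t a b

  collapse : ∀ {t} → t ≈ 0# → ∀ u v → (1# - t) * u + t * v ≈ u
  collapse t≈0 u v = trans (+-cong (*-congʳ (+-congˡ (-‿cong t≈0))) (*-congʳ t≈0))
    (solve 2 (λ u v → (con (+ 1) :- con (+ 0)) :* u :+ con (+ 0) :* v := u) refl u v)

  module _ (e x : Point) where
    private
      h : Point → Carrier
      h = height e x

    segment-height : ∀ {z a b} ((t , _) : z ∈[ a , b ]) → h z ≈ (1# - t) * h a + t * h b
    segment-height {z} {a} {b} (t , _ , _ , eq) = trans (height-cong e x eq) (height-affine e x t a b)

    -- Convexity of the closed half-plane: heights are affine along a segment.
    segment-below : ∀ {z a b} → ¬ 0# < h a → ¬ 0# < h b → z ∈[ a , b ] → ¬ 0# < h z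
    segment-below {z} {a} {b} ha≤0 hb≤0 z∈@(t , 0≤t , t≤1 , _) 0<hz =
      nonneg-+ (nonneg-* (≤⇒nonneg t≤1) (neg ha≤0))
               (nonneg-* (0≤⇒nonneg 0≤t) (neg hb≤0))
        (pos-resp (trans (segment-height z∈)
          (solve 3 (λ t a b → (con (+ 1) :- t) :* a :+ t :* b :=
            :- ((con (+ 1) :- t) :* :- a :+ t :* :- b)) refl t (h a) (h b))) 0<hz)
      where
      neg : ∀ {y} → ¬ 0# < y → ¬ 0# < - - y
      neg {y} y≤0 0<--y = y≤0 (pos-resp (solve 1 (λ y → :- :- y := y) refl y) 0<--y)

    -- As `x` has height 0, the height of `z` is `t` times that of `b`, so `t` cannot be positive.
    segment-pinch : ∀ {z b} → 0# < h b → ¬ 0# < h z → z ∈[ x , b ] → z ≈ₚ x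
    segment-pinch {z} {b₁ , b₂} 0<hb hz≤0 z∈@(t , 0≤t , t≤1 , eq₁ , eq₂) =
      trans eq₁ (collapse t≈0 (proj₁ x) b₁) , trans eq₂ (collapse t≈0 (proj₂ x) b₂)
      where
      b : Point
      b = b₁ , b₂

      t≈0 : t ≈ 0#
      t≈0 = zero-by-sign
        (λ 0<t → hz≤0 (pos-resp (sym (trans (segment-height z∈)
          (trans (+-congʳ (*-congˡ (height-base e x)))
            (solve 2 (λ t y → (con (+ 1) :- t) :* con (+ 0) :+ t :* y := t :* y) refl t (h b)))))
          (*-positive 0<t 0<hb)))
        (0≤⇒nonneg 0≤t)

    -- Convexity of the open half-plane, in the doubly negated form that suffices for refutations.
    -- If `h z` is not positive, `0# < t` excludes `0# < 1# - t`, so `t` would be 1 and `h z`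
    -- positive; hence `t` is 0 and `h z` equals `h a`.
    segment-above : ∀ {z a b} → 0# < h a → 0# < h b → z ∈[ a , b ] → ¬ ¬ 0# < h z
    segment-above {z} {a} {b} 0<ha 0<hb z∈@(t , 0≤t , t≤1 , _) hz≤0 =
      hz≤0 (pos-resp (sym (trans (segment-height z∈) (collapse t≈0 (h a) (h b)))) 0<ha)
      where
      1-t≈0 : 0# < t → 1# - t ≈ 0#
      1-t≈0 0<t = zero-by-sign
        (λ 0<1-t → hz≤0 (pos-resp (sym (segment-height z∈))
          (pos-+ (*-positive 0<1-t 0<ha) (*-positive 0<t 0<hb))))
        (≤⇒nonneg t≤1)

      t≈0 : t ≈ 0#
      t≈0 = zero-by-sign
        (λ 0<t → hz≤0 (pos-resp (sym (trans (segment-height z∈)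
          (trans (+-congʳ (*-congʳ (1-t≈0 0<t)))
            (solve 2 (λ y z → con (+ 0) :* y :+ z := z) refl (h a) (t * h b)))))
          (*-positive 0<t 0<hb)))
        (0≤⇒nonneg 0≤t)

  line : ∀ p q → proj₁ q - proj₁ p # 0# → Line
  line (p₁ , p₂) (q₁ , q₂) q₁#p₁ = record
    { α = - (q₂ - p₂) ; β = q₁ - p₁ ; γ = (q₂ - p₂) * p₁ - (q₁ - p₁) * p₂
    ; nondegenerate = inj₂ q₁#p₁ }

  abstract
    liesOff-line : ∀ p q (q#p : proj₁ q - proj₁ p # 0#) r → r LiesOff line p q q#p → side p q r # 0#
    liesOff-line (p₁ , p₂) (q₁ , q₂) q#p (r₁ , r₂) = #-respˡ (solve 6 (λ p₁ p₂ q₁ q₂ r₁ r₂ →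
      let p = p₁ , p₂ ; q = q₁ , q₂ ; r = r₁ , r₂ in
      :- (q₂ :- p₂) :* r₁ :+ (q₁ :- p₁) :* r₂ :+ ((q₂ :- p₂) :* p₁ :- (q₁ :- p₁) :* p₂) :=
      :side p q r) refl p₁ p₂ q₁ q₂ r₁ r₂)

  -- The vertical line through `p` misses another point, say `a`, so `pa` is not vertical and `line`
  -- applies. It contains `p` and `a`, hence misses the third point, and apartness of the linear
  -- form from 0 gives a sign.
  nonCollinear⇒side : ∀ {p q r} → NonCollinear p q r → 0# < side p q r ⊎ 0# < side p r q
  nonCollinear⇒side {p} {q} {r} nc = [ ⊥-elim ∘ p-on , [ via-q , via-r ]′ ]′ (nc vertical)
    where
    1#0 : 1# # 0#
    1#0 = invertible⇒# (1# , solve 0 (con (+ 1) :* (con (+ 1) :- con (+ 0)) := con (+ 1)) refl ,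
      solve 0 ((con (+ 1) :- con (+ 0)) :* con (+ 1) := con (+ 1)) refl)

    vertical : Line
    vertical = record { α = 1# ; β = 0# ; γ = - proj₁ p ; nondegenerate = inj₁ 1#0 }

    off : ∀ s → s LiesOff vertical → proj₁ s - proj₁ p # 0#
    off (s₁ , s₂) = #-respˡ (solve 3 (λ s₁ s₂ p₁ →
      con (+ 1) :* s₁ :+ con (+ 0) :* s₂ :+ :- p₁ := s₁ :- p₁) refl s₁ s₂ (proj₁ p))

    p-on : ¬ p LiesOff vertical
    p-on p-off = #-irrefl (-‿inverseʳ (proj₁ p)) (off p p-off)

    oriented : ∀ a b → a LiesOff vertical →
      (∀ (L : Line) → p LiesOff L ⊎ a LiesOff L ⊎ b LiesOff L) → 0# < side p a b ⊎ 0# < side p b a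
    oriented a b a-off nc′ with nc′ (line p a (off a a-off))
    ... | inj₁ p-off = ⊥-elim (#-irrefl (height-base (a ⊝ p) p) (liesOff-line p a (off a a-off) p p-off))
    ... | inj₂ (inj₁ a-off′) = ⊥-elim (#-irrefl (side-diagonal p a) (liesOff-line p a (off a a-off) a a-off′))
    ... | inj₂ (inj₂ b-off) = Sum.map id (pos-resp (sym (side-swap p b a))) (signed (liesOff-line p a (off a a-off) b b-off))

    via-q : q LiesOff vertical → 0# < side p q r ⊎ 0# < side p r q
    via-q q-off = oriented q r q-off nc

    via-r : r LiesOff vertical → 0# < side p q r ⊎ 0# < side p r q
    via-r r-off = Sum.swap (oriented r q r-off (λ L → Sum.map id Sum.swap (nc L)))

-- Sorted lists and the angular order around a point.

module Lists {a ℓ : Level} {A : Set a} {R : Rel A ℓ} where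

  allPairs-++⁻ : ∀ xs {ys} → AllPairs R (xs ++ᴸ ys) →
    AllPairs R xs × AllPairs R ys × All (λ x → All (R x) ys) xs
  allPairs-++⁻ [] rs = [] , rs , []
  allPairs-++⁻ (x ∷ xs) (r ∷ rs) =
    let rs₁ , rs₂ , rs₁₂ = allPairs-++⁻ xs rs
        r₁ , r₂ = All.++⁻ xs r
    in r₁ ∷ rs₁ , rs₂ , r₂ ∷ rs₁₂

  greatest : ∀ x xs → AllPairs R (x ∷ xs) →
    ∃[ y ] (y ∈ x ∷ xs × All (λ s → s ≡ y ⊎ R s y) (x ∷ xs))
  greatest x [] _ = x , here ≡.refl , inj₁ ≡.refl ∷ []
  greatest x (x′ ∷ xs) (r ∷ rs) =
    let y , y∈ , below = greatest x′ xs rs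
    in y , there y∈ , inj₂ (All.lookup r y∈) ∷ below

module Configuration {c ℓ₁ ℓ₂ ℓ₃ : Level} (ℝ : RealNumbers c ℓ₁ ℓ₂ ℓ₃) {n : ℕ}
  (P : Fin n → Plane.Point ℝ) (general : Plane.NoThreeCollinear ℝ P) where
  open RealNumbers ℝ hiding (zero)
  open Plane ℝ
  open OrderedField ℝ
  open Vectors ℝ
  open RootedTrees {n}
  open Lists
  open CommutativeRing commutativeRing using (ring)
  open RingProperties ring using (-0#≈0#; -‿+-comm)

  Ahead : V → V → V → Set ℓ₃
  Ahead p s t = 0# < side (P p) (P s) (P t)

  Positive : Point → V → V → Set ℓ₃
  Positive e p s = 0# < height e (P p) (P s)

  ahead⇒≢ : ∀ {p s t} → Ahead p s t → s ≢ t
  ahead⇒≢ {p} {s} pst ≡.refl = zero⇒¬pos (side-diagonal (P p) (P s)) pst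

  positive⇒≢ : ∀ {e p s} → Positive e p s → p ≢ s
  positive⇒≢ {e} {p} 0<h ≡.refl = zero⇒¬pos (height-base e (P p)) 0<h

  ahead-total : ∀ {p s t} → p ≢ s → p ≢ t → s ≢ t → Ahead p s t ⊎ Ahead p t s
  ahead-total {p} {s} {t} p≢s p≢t s≢t = nonCollinear⇒side (general p s t p≢s p≢t s≢t)

  -- Otherwise `Ahead p u s`, and all the products in `cross-plücker` are positive although they sum
  -- to 0.
  ahead-trans : ∀ {e p s t u} → Positive e p s → Positive e p t → Positive e p u → s ≢ u →
    Ahead p s t → Ahead p t u → Ahead p s u
  ahead-trans {e} {p} {s} {t} {u} s⁺ t⁺ u⁺ s≢u pst ptu
    with ahead-total (positive⇒≢ s⁺) (positive⇒≢ u⁺) s≢u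
  ... | inj₁ psu = psu
  ... | inj₂ pus = ⊥-elim (pos-contra
    (cross-plücker e (P s ⊝ P p) (P t ⊝ P p) (P u ⊝ P p))
    (*-positive t⁺ pus) (pos-+ (*-positive s⁺ ptu) (*-positive u⁺ pst)))

  -- The points of the list lie in counterclockwise order around p, within an
  -- angle less than π.
  Fan : V → List V → Set ℓ₃
  Fan p xs = All (p ≢_) xs × AllPairs (Ahead p) xs

  fan-unique : ∀ {p xs} → Fan p xs → Unique (p ∷ xs)
  fan-unique (p≢ , order) = p≢ ∷ AllPairs.map ahead⇒≢ order

  insert : ∀ e p s xs → All (Positive e p) (s ∷ xs) → All (s ≢_) xs → AllPairs (Ahead p) xs →
    ∃[ ys ] (ys ↭ s ∷ xs × AllPairs (Ahead p) ys)
  insert e p s [] _ _ _ = s ∷ [] , ↭-refl , [] ∷ []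
  insert e p s (x ∷ xs) (s⁺ ∷ x⁺ ∷ xs⁺) (s≢x ∷ s≢xs) (x< ∷ sorted)
    with ahead-total (positive⇒≢ s⁺) (positive⇒≢ x⁺) s≢x
  ... | inj₁ psx = s ∷ x ∷ xs , ↭-refl ,
    (psx ∷ All.zipWith (λ (pxt , t⁺ , s≢t) → ahead-trans s⁺ x⁺ t⁺ s≢t psx pxt)
      (x< , All.zip (xs⁺ , s≢xs))) ∷ x< ∷ sorted
  ... | inj₂ pxs =
    let ys , ys↭ , sorted′ = insert e p s xs (s⁺ ∷ xs⁺) s≢xs sorted
    in x ∷ ys , ↭-trans (prep x ys↭) (↭.swap x s ↭-refl) ,
       All-resp-↭ (↭-sym ys↭) (pxs ∷ x<) ∷ sorted′

  -- Insertion sort; the half-plane given by `e` makes the circular order around `p` a linear one.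
  sort : ∀ e p xs → All (Positive e p) xs → Unique xs → ∃[ ys ] (ys ↭ xs × Fan p ys)
  sort e p xs xs⁺ unique =
    let ys , ys↭ , sorted = go xs xs⁺ unique
    in ys , ys↭ , All-resp-↭ (↭-sym ys↭) (All.map positive⇒≢ xs⁺) , sorted
    where
    go : ∀ xs → All (Positive e p) xs → Unique xs → ∃[ ys ] (ys ↭ xs × AllPairs (Ahead p) ys)
    go [] _ _ = [] , ↭-refl , []
    go (x ∷ xs) (x⁺ ∷ xs⁺) (x≢ ∷ unique) =
      let ys , ys↭ , sorted = go xs xs⁺ unique
          zs , zs↭ , sorted′ = insert e p x ys (x⁺ ∷ All-resp-↭ (↭-sym ys↭) xs⁺)
            (All-resp-↭ (↭-sym ys↭) x≢) sorted
      in zs , ↭-trans zs↭ (prep x ys↭) , sorted′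

  -- A new point x either lies to the left of the hull edge pq, which then
  -- remains a hull edge, or it sees all previous points in the half-plane
  -- bounded by the parallel to pq through x.
  hull-vertex : ∀ x y xs → Unique (x ∷ y ∷ xs) →
    ∃[ p ] ∃[ q ] ∃[ ys ] (p ∷ q ∷ ys ↭ x ∷ y ∷ xs × Fan p (q ∷ ys))
  hull-vertex x y [] ((x≢y ∷ []) ∷ _) = x , y , [] , ↭-refl , x≢y ∷ [] , [] ∷ []
  hull-vertex x y (z ∷ xs) (x≢ ∷ unique) with hull-vertex y z xs unique
  ... | p , q , ys , perm , fan@(p≢q ∷ p≢ys , q< ∷ sorted)
      with All-resp-↭ (↭-sym perm) x≢
  ...   | x≢p ∷ x≢q ∷ x≢ys with ahead-total p≢q (x≢p ∘ ≡.sym) (x≢q ∘ ≡.sym)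
  ...     | inj₁ pqx =
    let zs , zs↭ , p≢zs , sorted′ = sort (P q ⊝ P p) p (x ∷ ys) (pqx ∷ q<)
          (x≢ys ∷ AllPairs.map ahead⇒≢ sorted)
    in p , q , zs ,
       ↭-trans (prep p (prep q zs↭)) (↭-trans (↭.shift x (p ∷ q ∷ []) ys) (prep x perm)) ,
       p≢q ∷ p≢zs , All-resp-↭ (↭-sym zs↭) (pqx ∷ q<) ∷ sorted′
  ...     | inj₂ pxq with sort (P q ⊝ P p) x (p ∷ q ∷ ys) behind (fan-unique fan)
    where
    rebase : ∀ s → side (P p) (P x) (P q) + side (P p) (P q) (P s) ≈ height (P q ⊝ P p) (P x) (P s)
    rebase s = sym (height-rebase (P p) (P q) (P x) (P s))

    on-line : ∀ s → side (P p) (P q) (P s) ≈ 0# → Positive (P q ⊝ P p) x s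
    on-line s eq = pos-resp (trans (sym (trans (+-congˡ eq) (+-identityʳ _))) (rebase s)) pxq

    behind : All (Positive (P q ⊝ P p) x) (p ∷ q ∷ ys)
    behind = on-line p (height-base _ (P p)) ∷ on-line q (side-diagonal (P p) (P q)) ∷
      All.map (λ {t} pqt → pos-resp (rebase t) (pos-+ pxq pqt)) q<
  ...       | [] , zs↭ , _ = ⊥-elim (¬x∷xs↭[] (↭-sym zs↭))
  ...       | w ∷ ws , zs↭ , fan′ = x , w , ws , prep x (↭-trans zs↭ perm) , fan′

  -- Edges that meet only at common endpoints.

  Touch : V × V → V × V → Set _
  Touch (a , b) (u , v) = ∀ z → z ∈[ P a , P b ] → z ∈[ P u , P v ] →
    ∃[ w ] ((w ≡ a ⊎ w ≡ b) × (w ≡ u ⊎ w ≡ v) × z ≈ₚ P w)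

  -- An edge in the open half-plane that may have one end at `p`; `a ≢ b` keeps it from collapsing
  -- to `p`.
  Beyond : Point → V → V × V → Set ℓ₃
  Beyond e p (a , b) = (a ≡ p ⊎ Positive e p a) × (b ≡ p ⊎ Positive e p b) × a ≢ b

  -- With an end at `p`, `segment-pinch` applies; with both ends strictly above, the edge never
  -- reaches the closed lower side.
  pinch : ∀ e p {a b z} → Beyond e p (a , b) → z ∈[ P a , P b ] → ¬ 0# < height e (P p) z →
    (p ≡ a ⊎ p ≡ b) × z ≈ₚ P p
  pinch e p (inj₁ ≡.refl , inj₁ ≡.refl , a≢b) z∈ hz≤0 = ⊥-elim (a≢b ≡.refl)
  pinch e p (inj₁ ≡.refl , inj₂ b⁺ , a≢b) z∈ hz≤0 = inj₁ ≡.refl , segment-pinch e (P p) b⁺ hz≤0 z∈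
  pinch e p (inj₂ a⁺ , inj₁ ≡.refl , a≢b) z∈ hz≤0 =
    inj₂ ≡.refl , segment-pinch e (P p) a⁺ hz≤0 (segment-sym z∈)
  pinch e p (inj₂ a⁺ , inj₂ b⁺ , a≢b) z∈ hz≤0 = ⊥-elim (segment-above e (P p) a⁺ b⁺ z∈ hz≤0)

  opposite : ∀ {e p a} → a ≡ p ⊎ Positive e p a → ¬ Positive (⊝ e) p a
  opposite {e} {p} {a} (inj₁ ≡.refl) 0<h = positive⇒≢ 0<h ≡.refl
  opposite {e} {p} {a} (inj₂ a⁺) 0<h =
    pos-contra (trans (+-congˡ (height-⊝ e (P p) (P a))) (-‿inverseʳ _)) a⁺ 0<h

  opposite′ : ∀ {e p a} → a ≡ p ⊎ Positive (⊝ e) p a → ¬ Positive e p a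
  opposite′ {e} {p} {a} (inj₁ ≡.refl) 0<h = positive⇒≢ 0<h ≡.refl
  opposite′ {e} {p} {a} (inj₂ a⁻) 0<h = opposite {e} {p} {a} (inj₂ 0<h) a⁻

  -- By convexity a common point lies in both closed half-planes, and each edge meets the opposite
  -- one at most in `p`.
  touch-opposite : ∀ e p {ε ε′} → Beyond (⊝ e) p ε → Beyond e p ε′ → Touch ε ε′
  touch-opposite e p below@(a , b , _) above@(u , v , _) z z∈ z∈′ =
    let at-a , z≈p = pinch (⊝ e) p below z∈ (segment-below (⊝ e) (P p) (opposite u) (opposite v) z∈′)
        at-u , _ = pinch e p above z∈′ (segment-below e (P p) (opposite′ a) (opposite′ b) z∈)
    in p , at-a , at-u , z≈p

  -- The edge from `q` to `p` lies on the bounding line, hence in the closed half-plane that `ε`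
  -- meets at most in `q`.
  touch-line : ∀ e q p {ε} → height e (P q) (P p) ≈ 0# → Beyond e q ε → Touch ε (q , p)
  touch-line e q p p-on beyond z z∈ z∈′ =
    let at , z≈q = pinch e q beyond z∈ (segment-below e (P q)
          (zero⇒¬pos (height-base e (P q))) (zero⇒¬pos p-on) z∈′)
    in q , at , inj₁ ≡.refl , z≈q

  -- The sum of the vectors from `p` to `y` and to the last point `z` of `xs` points between the two
  -- parts. The height of a point is the sum of its sides with respect to `pz` and `py`, which never
  -- have opposite signs and never both vanish. The membership `w ∈ xs` makes `xs` nonempty.
  separate : ∀ p {w} xs y ys → w ∈ xs → AllPairs (Ahead p) (xs ++ᴸ y ∷ ys) →
    ∃[ e ] (All (Positive (⊝ e) p) xs × All (Positive e p) (y ∷ ys))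
  separate p (x ∷ xs) y ys _ sorted with allPairs-++⁻ (x ∷ xs) sorted
  ... | sorted-xs , y< ∷ _ , across with greatest x xs sorted-xs
  ...   | z , z∈ , z-max = e , All.zipWith before (z-max , across) , after
    where
    e : Point
    e = (P z ⊝ P p) ⊹ (P y ⊝ P p)

    pzy : Ahead p z y
    pzy = All.head (All.lookup across z∈)

    before : ∀ {s} → (s ≡ z ⊎ Ahead p s z) × All (Ahead p s) (y ∷ ys) → Positive (⊝ e) p s
    before {s} (s≤z , psy ∷ _) = pos-resp
        (trans (sym (trans (-‿cong (height-sum (P p) (P z) (P y) (P s))) (sym (-‿+-comm _ _))))
          (sym (height-⊝ e (P p) (P s))))
        (add s≤z)
      where
      add : s ≡ z ⊎ Ahead p s z → 0# < - side (P p) (P z) (P s) + - side (P p) (P y) (P s)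
      add (inj₁ ≡.refl) = pos-resp (sym (trans (+-cong
        (trans (-‿cong (side-diagonal (P p) (P s))) -0#≈0#) (sym (side-swap (P p) (P s) (P y))))
        (+-identityˡ _))) psy
      add (inj₂ psz) = pos-+ (pos-resp (side-swap (P p) (P s) (P z)) psz)
        (pos-resp (side-swap (P p) (P s) (P y)) psy)

    sum : ∀ t → side (P p) (P z) (P t) + side (P p) (P y) (P t) ≈ height e (P p) (P t)
    sum t = sym (height-sum (P p) (P z) (P y) (P t))

    after : All (Positive e p) (y ∷ ys)
    after =
      pos-resp (trans (sym (trans (+-congˡ (side-diagonal (P p) (P y))) (+-identityʳ _))) (sum y)) pzy ∷
      All.zipWith (λ {t} (pzt , pyt) → pos-resp (sum t) (pos-+ pzt pyt))
        (All.tail (All.lookup across z∈) , y<)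

  -- Recursive construction of the tree.

  module Construction (ch : V → ℕ) where
    open import Data.Nat using () renaming (_+_ to _⊕_; _*_ to _⊛_; _≤_ to _≼_)
    open Balance ch

    -- Prescribed degrees below the root: `suc (ch x)` counts the children of `x` and its parent.
    weight : List V → V → ℕ
    weight xs v = sumᴸ (map (λ x → suc (ch x) ⊛ δ x v) xs)

    weight-↭ : ∀ {xs ys} → xs ↭ ys → ∀ v → weight xs v ≡ weight ys v
    weight-↭ xs↭ys v = sum-↭ (↭.map⁺ _ xs↭ys)

    weight-++ : ∀ xs ys v → weight (xs ++ᴸ ys) v ≡ weight xs v ⊕ weight ys v
    weight-++ xs ys v = ≡.trans (≡.cong sumᴸ (List.map-++ _ xs ys)) (sum-++ (map _ xs) (map _ ys))

    weight-∉ : ∀ {v} xs → All (v ≢_) xs → weight xs v ≡ 0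
    weight-∉ [] [] = ≡.refl
    weight-∉ (x ∷ xs) (v≢x ∷ v∉) rewrite δ-≢ (v≢x ∘ ≡.sym) | weight-∉ xs v∉ =
      ≡.trans (ℕ.+-identityʳ _) (ℕ.*-zeroʳ (ch x))

    weight-∈ : ∀ {v} xs → Unique xs → v ∈ xs → weight xs v ≡ suc (ch v)
    weight-∈ (x ∷ xs) (x∉ ∷ unique) (here ≡.refl) rewrite δ-refl x | weight-∉ xs x∉ =
      ≡.trans (ℕ.+-identityʳ _) (≡.cong suc (ℕ.*-identityʳ (ch x)))
    weight-∈ {v} (x ∷ xs) (x∉ ∷ unique) (there v∈)
      rewrite δ-≢ (All.lookup x∉ v∈) | weight-∈ xs unique v∈ =
      ≡.cong (_⊕ suc (ch v)) (ℕ.*-zeroʳ (ch x))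

    valence-++ : ∀ es fs v → valence (es ++ᴸ fs) v ≡ valence es v ⊕ valence fs v
    valence-++ es fs v = ≡.trans (≡.cong sumᴸ (List.map-++ _ es fs)) (sum-++ (map _ es) (map _ fs))

    -- Allows a sublist to be sorted anew around `q`.
    balanced-↭ : ∀ {k xs ys} → xs ↭ ys → Balanced k xs → Balanced k ys
    balanced-↭ {k} xs↭ys (eq , empty) =
      ≡.trans (≡.cong (_⊕ k) (sum-↭ (↭.map⁺ ch (↭-sym xs↭ys)))) (≡.trans eq (↭-length xs↭ys)) ,
      λ k≡0 → ↭-empty-inv (≡.subst (_ ↭_) (empty k≡0) (↭-sym xs↭ys))

    -- The root has `k` edges whatever `ch p` is, so trees sharing a root can be united and their
    -- numbers of children added.
    record Tree (p : V) (xs : List V) (k : ℕ) : Set (c ⊔ ℓ₁ ⊔ ℓ₃) where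
      field
        edges   : List (V × V)
        grown   : Grown p edges
        spans   : children edges ↭ xs
        degrees : ∀ v → valence edges v ≡ k ⊛ δ p v ⊕ weight xs v
        planar  : AllPairs Touch edges

      vertex : ∀ {v} → v ∈ p ∷ children edges → v ∈ p ∷ xs
      vertex = ∈-resp-↭ (prep p spans)

      inside : All (λ ε → proj₁ ε ∈ p ∷ xs × proj₂ ε ∈ p ∷ xs × proj₁ ε ≢ proj₂ ε) edges
      inside = All.zipWith (λ ((a∈ , b∈) , a≢b) → vertex a∈ , vertex b∈ , a≢b)
        (edge-inside grown , edge-proper grown)

      beyond : ∀ e → All (Positive e p) xs → All (Beyond e p) edges
      beyond e xs⁺ = All.map (λ (a∈ , b∈ , a≢b) → strict a∈ , strict b∈ , a≢b) inside
        where
        strict : ∀ {a} → a ∈ p ∷ xs → a ≡ p ⊎ Positive e p a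
        strict (here a≡p) = inj₁ a≡p
        strict (there a∈) = inj₂ (All.lookup xs⁺ a∈)

    tree-↭ : ∀ {p xs ys k} → xs ↭ ys → Tree p xs k → Tree p ys k
    tree-↭ xs↭ys t = record
      { edges = edges ; grown = grown ; spans = ↭-trans spans xs↭ys
      ; degrees = λ v → ≡.trans (degrees v) (≡.cong (_ ⊕_) (weight-↭ xs↭ys v)) ; planar = planar }
      where open Tree t

    module Split (p q : V) (as cs ds : List V) (fan : Fan p ((as ++ᴸ q ∷ cs) ++ᴸ ds)) where
      private
        e : Point
        e = P q ⊝ P p

        order : AllPairs (Ahead p) (as ++ᴸ q ∷ cs) × AllPairs (Ahead p) ds × _
        order = allPairs-++⁻ (as ++ᴸ q ∷ cs) (proj₂ fan)

        order′ : AllPairs (Ahead p) as × AllPairs (Ahead p) (q ∷ cs) × All (λ x → All (Ahead p x) (q ∷ cs)) as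
        order′ = allPairs-++⁻ as (proj₁ order)

        height-q : ∀ s → height e (P q) (P s) ≈ side (P p) (P q) (P s)
        height-q s = trans (height-rebase (P p) (P q) (P q) (P s))
          (trans (+-congʳ (side-diagonal (P p) (P q))) (+-identityˡ _))

      -- Points before `q` in the fan lie on the negative side of `pq`; heights are taken from `q`,
      -- which lies on that line and roots their tree.
      left : All (Positive (⊝ e) q) as
      left = All.map (λ {s} psq → pos-resp (trans (side-swap (P p) (P s) (P q))
          (sym (trans (height-⊝ e (P q) (P s)) (-‿cong (height-q s))))) (All.head psq))
        (proj₂ (proj₂ order′))

      right : All (Positive e q) cs
      right = All.map (λ {s} → pos-resp (sym (height-q s))) (AllPairs.head (proj₁ (proj₂ order′)))

      unique-left : Unique as
      unique-left = AllPairs.map ahead⇒≢ (proj₁ order′)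

      unique-right : Unique cs
      unique-right = AllPairs.map ahead⇒≢ (AllPairs.tail (proj₁ (proj₂ order′)))

      fan-rest : Fan p ds
      fan-rest = All.++⁻ʳ (as ++ᴸ q ∷ cs) (proj₁ fan) , proj₁ (proj₂ order)

      module _ {i j k : ℕ} (tₐ : Tree q as i) (tᶜ : Tree q cs j) (tᵈ : Tree p ds k)
        (chq : ch q ≡ i ⊕ j) where
        private
          module A = Tree tₐ
          module C = Tree tᶜ
          module D = Tree tᵈ

          distinct : ∀ {x} → x ∈ as ++ᴸ q ∷ cs → All (x ≢_) (p ∷ ds)
          distinct x∈ = (All.lookup (proj₁ fan) (∈-++⁺ˡ x∈) ∘ ≡.sym) ∷
            All.map ahead⇒≢ (All.lookup (proj₂ (proj₂ order)) x∈)

          q∈ : q ∈ as ++ᴸ q ∷ cs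
          q∈ = ∈-++⁺ʳ as (here ≡.refl)

          spread : ∀ {x y} ys → All (x ≢_) ys → All (x ≢_) (y ∷ ds) → All (x ≢_) (y ∷ ys ++ᴸ children D.edges)
          spread ys x≢ys (x≢y ∷ x≢ds) =
            x≢y ∷ All.++⁺ x≢ys (All-resp-↭ (↭-sym D.spans) x≢ds)

          -- Order of growth: first `D`, then the edge to `q`, then `C` and `A`, which both hang
          -- from `q`.
          grown-q : Grown p ((q , p) ∷ D.edges)
          grown-q = leaf (here ≡.refl) (All.All¬⇒¬Any (spread [] [] (distinct q∈))) D.grown

          grown-C : Grown p (C.edges ++ᴸ (q , p) ∷ D.edges)
          grown-C = ++-grown grown-q (there (here ≡.refl)) C.grown λ v∈ →
            let v∈cs = ∈-resp-↭ C.spans v∈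
            in All.All¬⇒¬Any (spread (q ∷ [])
                 ((positive⇒≢ (All.lookup right v∈cs) ∘ ≡.sym) ∷ [])
                 (distinct (∈-++⁺ʳ as (there v∈cs))))

          children-C : children (C.edges ++ᴸ (q , p) ∷ D.edges) ≡ children C.edges ++ᴸ q ∷ children D.edges
          children-C = List.map-++ proj₁ C.edges _

          q∈′ : q ∈ p ∷ children (C.edges ++ᴸ (q , p) ∷ D.edges)
          q∈′ = there (≡.subst (q ∈_) (≡.sym children-C) (∈-++⁺ʳ (children C.edges) (here ≡.refl)))

          grown-A : Grown p (A.edges ++ᴸ C.edges ++ᴸ (q , p) ∷ D.edges)
          grown-A = ++-grown grown-C q∈′ A.grown λ {v} v∈ →
            let v∈as = ∈-resp-↭ A.spans v∈
                v≢pds = distinct (∈-++⁺ˡ v∈as)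
                v≢qcs = All.map ahead⇒≢ (All.lookup (proj₂ (proj₂ order′)) v∈as)
            in All.All¬⇒¬Any (All.head v≢pds ∷ ≡.subst (All (v ≢_)) (≡.sym children-C)
                 (All.++⁺ (All-resp-↭ (↭-sym C.spans) (All.tail v≢qcs))
                   (All.head v≢qcs ∷ All-resp-↭ (↭-sym D.spans) (All.tail v≢pds))))

          -- A line through `p` separates the block from `ds`. An empty `ds` offers no first point
          -- to cut at, but its tree has no edges either.
          apart : ∀ ds → AllPairs (Ahead p) ((as ++ᴸ q ∷ cs) ++ᴸ ds) → (t : Tree p ds k) → ∀ {a b} →
            a ∈ p ∷ as ++ᴸ q ∷ cs → b ∈ p ∷ as ++ᴸ q ∷ cs → a ≢ b → All (Touch (a , b)) (Tree.edges t)
          apart [] _ t _ _ _ with Tree.edges t | Tree.spans t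
          ... | []    | _    = []
          ... | _ ∷ _ | perm = ⊥-elim (¬x∷xs↭[] perm)
          apart (d ∷ ds) sorted t {a} {b} a∈ b∈ a≢b
            with separate p (as ++ᴸ q ∷ cs) d ds q∈ sorted
          ... | e′ , below , above =
            All.map (touch-opposite e′ p (strict a∈ , strict b∈ , a≢b)) (Tree.beyond t e′ above)
            where
            strict : ∀ {x} → x ∈ p ∷ as ++ᴸ q ∷ cs → x ≡ p ⊎ Positive (⊝ e′) p x
            strict (here x≡p) = inj₁ x≡p
            strict (there x∈) = inj₂ (All.lookup below x∈)

          -- The line `pq` separates the two trees, which share the root `q`.
          touch-AC : All (λ ε → All (Touch ε) C.edges) A.edges
          touch-AC = All.map (λ below → All.map (touch-opposite e q below) (C.beyond e right))
            (A.beyond (⊝ e) left)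

          touch-Aq : All (λ ε → Touch ε (q , p)) A.edges
          touch-Aq = All.map (touch-line (⊝ e) q p
              (trans (height-⊝ e (P q) (P p)) (trans (-‿cong (height-end (P p) (P q))) -0#≈0#)))
            (A.beyond (⊝ e) left)

          touch-Cq : All (λ ε → Touch ε (q , p)) C.edges
          touch-Cq = All.map (touch-line e q p (height-end (P p) (P q))) (C.beyond e right)

          touch-AD : All (λ ε → All (Touch ε) D.edges) A.edges
          touch-AD = All.map (λ (a∈ , b∈ , a≢b) → apart ds (proj₂ fan) tᵈ (up a∈) (up b∈) a≢b) A.inside
            where
            up : ∀ {x} → x ∈ q ∷ as → x ∈ p ∷ as ++ᴸ q ∷ cs
            up (here ≡.refl) = there q∈
            up (there x∈) = there (∈-++⁺ˡ x∈)

          touch-CD : All (λ ε → All (Touch ε) D.edges) C.edges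
          touch-CD = All.map (λ (a∈ , b∈ , a≢b) →
            apart ds (proj₂ fan) tᵈ (there (∈-++⁺ʳ as a∈)) (there (∈-++⁺ʳ as b∈)) a≢b) C.inside

          touch-qD : All (Touch (q , p)) D.edges
          touch-qD = apart ds (proj₂ fan) tᵈ (there q∈) (here ≡.refl) (All.head (distinct q∈))

          planar : AllPairs Touch (A.edges ++ᴸ C.edges ++ᴸ (q , p) ∷ D.edges)
          planar = AllPairs.++⁺ A.planar
            (AllPairs.++⁺ C.planar (touch-qD ∷ D.planar) (All.zipWith (λ (x , xs) → x ∷ xs) (touch-Cq , touch-CD)))
            (All.zipWith (λ (ys , x , xs) → All.++⁺ ys (x ∷ xs)) (touch-AC , All.zip (touch-Aq , touch-AD)))

          spans : children (A.edges ++ᴸ C.edges ++ᴸ (q , p) ∷ D.edges) ↭ (as ++ᴸ q ∷ cs) ++ᴸ ds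
          spans = begin
            children (A.edges ++ᴸ C.edges ++ᴸ (q , p) ∷ D.edges)
              ≡⟨ ≡.trans (List.map-++ proj₁ A.edges _) (≡.cong (children A.edges ++ᴸ_) children-C) ⟩
            children A.edges ++ᴸ children C.edges ++ᴸ q ∷ children D.edges
              ↭⟨ ↭.++⁺ A.spans (↭.++⁺ C.spans (prep q D.spans)) ⟩
            as ++ᴸ cs ++ᴸ q ∷ ds
              ↭⟨ ↭.++⁺ˡ as (↭.shift q cs ds) ⟩
            as ++ᴸ (q ∷ cs) ++ᴸ ds
              ≡⟨ List.++-assoc as (q ∷ cs) ds ⟨
            (as ++ᴸ q ∷ cs) ++ᴸ ds ∎
            where open ↭.PermutationReasoning

          degrees : ∀ v → valence (A.edges ++ᴸ C.edges ++ᴸ (q , p) ∷ D.edges) v ≡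
            suc k ⊛ δ p v ⊕ weight ((as ++ᴸ q ∷ cs) ++ᴸ ds) v
          degrees v = begin
            valence (A.edges ++ᴸ C.edges ++ᴸ (q , p) ∷ D.edges) v
              ≡⟨ ≡.trans (valence-++ A.edges _ v)
                   (≡.cong₂ _⊕_ (A.degrees v) (≡.trans (valence-++ C.edges _ v)
                     (≡.cong₂ _⊕_ (C.degrees v) (≡.cong (δ q v ⊕ δ p v ⊕_) (D.degrees v))))) ⟩
            i ⊛ δ q v ⊕ weight as v ⊕ (j ⊛ δ q v ⊕ weight cs v ⊕
              (δ q v ⊕ δ p v ⊕ (k ⊛ δ p v ⊕ weight ds v)))
              -- The edge joining `q` to `p` adds one at both ends: `q` has `i + j` children and a
              -- parent, and `p` has one child more than in `D`.
              ≡⟨ arith i j k (δ q v) (δ p v) (weight as v) (weight cs v) (weight ds v) ⟩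
            suc k ⊛ δ p v ⊕ (weight as v ⊕ (suc (i ⊕ j) ⊛ δ q v ⊕ weight cs v) ⊕ weight ds v)
              ≡⟨ ≡.cong (λ m → suc k ⊛ δ p v ⊕ (weight as v ⊕ (suc m ⊛ δ q v ⊕ weight cs v) ⊕ weight ds v)) chq ⟨
            suc k ⊛ δ p v ⊕ (weight as v ⊕ weight (q ∷ cs) v ⊕ weight ds v)
              ≡⟨ ≡.cong (suc k ⊛ δ p v ⊕_) (≡.trans (weight-++ (as ++ᴸ q ∷ cs) ds v)
                   (≡.cong (_⊕ weight ds v) (weight-++ as (q ∷ cs) v))) ⟨
            suc k ⊛ δ p v ⊕ weight ((as ++ᴸ q ∷ cs) ++ᴸ ds) v ∎
            where
            open ≡.≡-Reasoning
            arith : ∀ i j k x y a c d →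
              i ⊛ x ⊕ a ⊕ (j ⊛ x ⊕ c ⊕ (x ⊕ y ⊕ (k ⊛ y ⊕ d))) ≡
              suc k ⊛ y ⊕ (a ⊕ (suc (i ⊕ j) ⊛ x ⊕ c) ⊕ d)
            arith = solve-∀

        assemble : Tree p ((as ++ᴸ q ∷ cs) ++ᴸ ds) (suc k)
        assemble = record
          { edges = A.edges ++ᴸ C.edges ++ᴸ (q , p) ∷ D.edges
          ; grown = grown-A ; spans = spans ; degrees = degrees ; planar = planar }

    -- The bound `m` carries the recursion, since re-sorted lists are not structurally smaller. For
    -- `k = 0` the second half of `Balanced` leaves no descendants.
    build : ∀ m p xs k → length xs ≼ m → Fan p xs → Balanced k xs → Tree p xs k
    build m p xs zero _ _ (_ , empty) with empty ≡.refl
    ... | ≡.refl = record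
      { edges = [] ; grown = bare ; spans = ↭-refl ; degrees = λ _ → ≡.refl ; planar = [] }
    build zero p [] (suc k) _ _ (() , _)
    build (suc m) p xs (suc k) size fan bal with decompose k xs bal
    ... | as , q , cs , ds , i , j , ≡.refl , bal-as , bal-cs , chq , bal-ds =
      -- `as` and `cs` lie on opposite sides of `pq`, hence the opposite directions for sorting
      -- around `q`; `ds` keeps `p` and its order.
      let as′ , as′↭ , fan-as = sort (⊝ (P q ⊝ P p)) q as left unique-left
          cs′ , cs′↭ , fan-cs = sort (P q ⊝ P p) q cs right unique-right
      in assemble
        (tree-↭ as′↭ (build m q as′ i (≡.subst (_≼ m) (≡.sym (↭-length as′↭)) size-as) fan-as
          (balanced-↭ (↭-sym as′↭) bal-as)))
        (tree-↭ cs′↭ (build m q cs′ j (≡.subst (_≼ m) (≡.sym (↭-length cs′↭)) size-cs) fan-cs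
          (balanced-↭ (↭-sym cs′↭) bal-cs)))
        (build m p ds k size-ds fan-rest bal-ds) chq
      where
      open Split p q as cs ds fan

      total : suc (length as ⊕ length cs ⊕ length ds) ≼ suc m
      total = ≡.subst (_≼ suc m) (≡.trans (List.length-++ (as ++ᴸ q ∷ cs))
        (≡.cong (_⊕ length ds) (≡.trans (List.length-++ as) (ℕ.+-suc (length as) (length cs))))) size

      size-as : length as ≼ m
      size-as = ℕ.m+n≤o⇒m≤o _ (ℕ.m+n≤o⇒m≤o _ (ℕ.s≤s⁻¹ total))

      size-cs : length cs ≼ m
      size-cs = ℕ.m+n≤o⇒n≤o (length as) (ℕ.m+n≤o⇒m≤o _ (ℕ.s≤s⁻¹ total))

      size-ds : length ds ≼ m
      size-ds = ℕ.m+n≤o⇒n≤o (length as ⊕ length cs) (ℕ.s≤s⁻¹ total)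

    -- Edges at different positions of the list are covered by `planar`; at the same position they
    -- would agree up to orientation, which is excluded.
    graph-noncrossing : ∀ {root es} (g : Grown root es) → AllPairs Touch es → NonCrossing P (graph g)
    graph-noncrossing {es = es} g planar a b u v ab uv ab≢uv ab≢vu z z∈ z∈′ =
      go es planar (does⇒ (adjacent? es a b) ab) (does⇒ (adjacent? es u v) uv)
      where
      Meets : Set _
      Meets = ∃[ w ] ((w ≡ a ⊎ w ≡ b) × (w ≡ u ⊎ w ≡ v) × z ≈ₚ P w)

      undirect : ∀ ε ε′ → Joins ε a b → Joins ε′ u v → Touch ε ε′ → Meets
      undirect (c , p) (c′ , p′) ε-ab ε′-uv touch =
        let w , at , at′ , z≈w = touch z (along ε-ab z∈) (along ε′-uv z∈′)
        in w , ends ε-ab at , ends ε′-uv at′ , z≈w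
        where
        along : ∀ {c p x y} → Joins (c , p) x y → z ∈[ P x , P y ] → z ∈[ P c , P p ]
        along (inj₁ (≡.refl , ≡.refl)) z∈xy = z∈xy
        along (inj₂ (≡.refl , ≡.refl)) z∈xy = segment-sym z∈xy

        ends : ∀ {c p x y w} → Joins (c , p) x y → w ≡ c ⊎ w ≡ p → w ≡ x ⊎ w ≡ y
        ends (inj₁ (≡.refl , ≡.refl)) at = at
        ends (inj₂ (≡.refl , ≡.refl)) at = Sum.swap at

      same : ∀ ε → Joins ε a b → Joins ε u v → ⊥
      same (c , p) (inj₁ (≡.refl , ≡.refl)) (inj₁ (≡.refl , ≡.refl)) = ab≢uv (≡.refl , ≡.refl)
      same (c , p) (inj₁ (≡.refl , ≡.refl)) (inj₂ (≡.refl , ≡.refl)) = ab≢vu (≡.refl , ≡.refl)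
      same (c , p) (inj₂ (≡.refl , ≡.refl)) (inj₁ (≡.refl , ≡.refl)) = ab≢vu (≡.refl , ≡.refl)
      same (c , p) (inj₂ (≡.refl , ≡.refl)) (inj₂ (≡.refl , ≡.refl)) = ab≢uv (≡.refl , ≡.refl)

      touch-sym : ∀ {ε ε′} → Touch ε ε′ → Touch ε′ ε
      touch-sym touch y y∈ y∈′ = let w , at , at′ , y≈w = touch y y∈′ y∈ in w , at′ , at , y≈w

      go : ∀ es → AllPairs Touch es → Adjacent es a b → Adjacent es u v → Meets
      go (ε ∷ es) (touch ∷ planar) (here ε-ab) (here ε-uv) = ⊥-elim (same ε ε-ab ε-uv)
      go (ε ∷ es) (touch ∷ planar) (here ε-ab) (there a-uv) =
        let t , ε′-uv = All.lookupAny touch a-uv in undirect ε _ ε-ab ε′-uv t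
      go (ε ∷ es) (touch ∷ planar) (there a-ab) (here ε-uv) =
        let t , ε′-ab = All.lookupAny touch a-ab in undirect _ ε ε′-ab ε-uv (touch-sym t)
      go (ε ∷ es) (touch ∷ planar) (there a-ab) (there a-uv) = go es planar a-ab a-uv

    abstract
      -- The balance says that the degrees `suc (ch v)` add up to `2n - 2`. A hull vertex `p`
      -- becomes the root; having no parent, it gets `suc (ch p)` children, so its degree obeys the
      -- same formula.
      spanning-tree : ∀ x y xs → x ∷ y ∷ xs ≡ allFin n → load (allFin n) ⊕ 2 ≡ n →
        Σ[ G ∈ Graph n ] (IsNonCrossingSpanningTree P G × (∀ v → Graph.degree G v ≡ suc (ch v)))
      spanning-tree x y xs all balance
        with hull-vertex x y xs (≡.subst Unique (≡.sym all) (allFin⁺ n))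
      ... | p , q , ys , perm , fan =
        graph grown ,
        (graph-tree grown (λ v → ∈-resp-↭ (↭-sym (prep p spans)) (everywhere v)) ,
         graph-noncrossing grown planar) ,
        λ v → ≡.trans (graph-degree grown v) (≡.trans (degrees v)
          (weight-∈ (p ∷ q ∷ ys) (fan-unique fan) (everywhere v)))
        where
        perm′ : p ∷ q ∷ ys ↭ allFin n
        perm′ = ≡.subst (_ ↭_) all perm

        everywhere : ∀ v → v ∈ p ∷ q ∷ ys
        everywhere v = ∈-resp-↭ (↭-sym perm′) (∈-allFin v)

        -- Of the 2 in `balance`, one is the root among the `n` vertices, the other its additional
        -- child.
        root-balance : load (q ∷ ys) ⊕ suc (ch p) ≡ length (q ∷ ys)
        root-balance = ℕ.suc-injective (≡.trans (arith (load (q ∷ ys)) (ch p))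
          (≡.trans (≡.cong (_⊕ 2) (sum-↭ (↭.map⁺ ch perm′)))
            (≡.trans balance (≡.trans (≡.sym (List.length-tabulate id)) (≡.sym (↭-length perm′))))))
          where
          arith : ∀ l a → suc (l ⊕ suc a) ≡ a ⊕ l ⊕ 2
          arith = solve-∀

        open Tree (build _ p (q ∷ ys) (suc (ch p)) ℕ.≤-refl fan (root-balance , λ ()))

-- Finite sums and the lowering of degree bounds.

module Totals where
  open import Data.Nat using (_+_; _≤_)
  open ≡ using (refl; sym; trans; cong; cong₂)

  total : ∀ {r} → (Fin r → ℕ) → ℕ
  total g = Vec.sum (Vec.tabulate g)

  total-cong : ∀ {r} {g h : Fin r → ℕ} → (∀ i → g i ≡ h i) → total g ≡ total h
  total-cong g≗h = cong Vec.sum (tabulate-cong g≗h)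

  total-suc : ∀ {r} (h : Fin r → ℕ) → total (suc ∘ h) ≡ r + total h
  total-suc {zero}  h = refl
  total-suc {suc r} h = trans (cong (suc (h zero) +_) (total-suc (h ∘ suc)))
    (arith (h zero) r (total (h ∘ suc)))
    where
    arith : ∀ a r t → suc a + (r + t) ≡ suc r + (a + t)
    arith = solve-∀

  total-zero : ∀ b → total {b} (λ _ → 0) ≡ 0
  total-zero zero    = refl
  total-zero (suc b) = total-zero b

  total-++ : ∀ {r b} (g : Fin r → ℕ) (h : Fin b → ℕ) → total (g Vector.++ h) ≡ total g + total h
  total-++ {zero}  g h = refl
  total-++ {suc r} {b} g h = trans
    (cong (g zero +_) (trans (total-cong tail) (total-++ (g ∘ suc) h)))
    (sym (ℕ.+-assoc (g zero) _ _))
    where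
    tail : ∀ i → (g Vector.++ h) (suc i) ≡ ((g ∘ suc) Vector.++ h) i
    tail i with splitAt r i
    ... | inj₁ _ = refl
    ... | inj₂ _ = refl

  sum-allFin : ∀ {n} (g : Fin n → ℕ) → sumᴸ (map g (allFin n)) ≡ total g
  sum-allFin g = trans (cong sumᴸ (List.map-tabulate id g)) (sum-tabulate g)
    where
    sum-tabulate : ∀ {n} (g : Fin n → ℕ) → sumᴸ (List.tabulate g) ≡ total g
    sum-tabulate {zero}  g = refl
    sum-tabulate {suc n} g = cong (g zero +_) (sum-tabulate (g ∘ suc))

  total-mono : ∀ {r} {h g : Fin r → ℕ} → (∀ i → h i ≤ g i) → total h ≤ total g
  total-mono {zero}  h≤g = ℕ.z≤n
  total-mono {suc r} h≤g = ℕ.+-mono-≤ (h≤g zero) (total-mono (h≤g ∘ suc))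

  -- The tail of `h` cannot make up for a smaller head, by `total-mono`, so the heads agree and the
  -- tails have equal totals.
  total-tight : ∀ {r} {h g : Fin r → ℕ} → (∀ i → h i ≤ g i) → total h ≡ total g → ∀ i → h i ≡ g i
  total-tight {suc r} {h} {g} h≤g eq = λ where
      zero    → head
      (suc i) → total-tight (h≤g ∘ suc)
        (ℕ.+-cancelˡ-≡ (h zero) _ _ (trans eq (cong (_+ total (g ∘ suc)) (sym head)))) i
    where
    head : h zero ≡ g zero
    head = ℕ.≤-antisym (h≤g zero) (ℕ.+-cancelʳ-≤ (total (g ∘ suc)) _ _
      (ℕ.≤-trans (ℕ.≤-reflexive (sym eq)) (ℕ.+-monoʳ-≤ (h zero) (total-mono (h≤g ∘ suc)))))

  -- Greedy choice: the first entry takes as much of `m` as `g zero` allows, and the tail takes the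
  -- rest.
  lower-to : ∀ {r} (g : Fin r → ℕ) m → m ≤ total g →
    ∃[ h ] ((∀ i → h i ≤ g i) × total h ≡ m)
  lower-to {zero}  g zero ℕ.z≤n = g , (λ ()) , refl
  lower-to {suc r} g m m≤ with lower-to (g ∘ suc) (m ℕ.∸ g zero) (ℕ.m≤n+o⇒m∸n≤o m (g zero) m≤)
  ... | h , h≤g , eq = h′ , h′≤g ,
    trans (cong₂ _+_ (ℕ.⊓-comm m (g zero)) eq) (ℕ.m⊓n+n∸m≡n (g zero) m)
    where
    h′ : Fin (suc r) → ℕ
    h′ zero    = m ℕ.⊓ g zero
    h′ (suc i) = h i

    h′≤g : ∀ i → h′ i ≤ g i
    h′≤g zero    = ℕ.m⊓n≤n m (g zero)
    h′≤g (suc i) = h≤g i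

  two-first : ∀ {n} → 2 ≤ n → ∃[ x ] ∃[ y ] ∃[ xs ] (x ∷ y ∷ xs ≡ allFin n)
  two-first (ℕ.s≤s (ℕ.s≤s _)) = zero , suc zero , _ , refl

-- Choice of the degrees for coloured points, and conclusion.

open import Data.Nat using (_+_; _∸_; _≤_)
open import Data.Vec using (sum; tabulate)
open import Data.Vec.Functional using (_++_)

theorem1 : {c ℓ₁ ℓ₂ ℓ₃ : Level} (ℝ : RealNumbers c ℓ₁ ℓ₂ ℓ₃) →
    let open Plane ℝ in
    (r b : ℕ) (R : Fin r → Point) (B : Fin b → Point) →
    Injective _≡_ _≈ₚ_ R →
    Injective _≡_ _≈ₚ_ B →
    (∀ i j → ¬ (R i ≈ₚ B j)) →
    NoThreeCollinear (R ++ B) →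
    (f : Fin r → ℕ) →
    (∀ i → 2 ≤ f i) →
    2 ≤ b →
    b ≤ sum (tabulate (λ i → f i ∸ 2)) + 2 →
    Σ[ G ∈ Graph (r + b) ]
    (let open Graph G in
    IsNonCrossingSpanningTree (R ++ B) G ×
    (∀ v → Leaf v ⇔ (∃[ j ] v ≡ r ↑ʳ j)) ×
    (∀ i → 2 ≤ degree (i ↑ˡ b) × degree (i ↑ˡ b) ≤ f i) ×
    (b ≡ sum (tabulate (λ i → f i ∸ 2)) + 2 →
    ∀ i → degree (i ↑ˡ b) ≡ f i))
theorem1 ℝ r b R B _ _ _ general f 2≤f 2≤b b≤ =
  G , tree , leaves ,
  (λ i → ≡.subst (2 ≤_) (≡.sym (red i)) (ℕ.s≤s (ℕ.s≤s ℕ.z≤n)) ,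
         ≡.subst (_≤ f i) (≡.sym (red i)) (bound i (h≤g i))) ,
  λ b≡ i → ≡.trans (red i) (≡.trans (≡.cong (λ k → suc (suc k)) (tight b≡ i)) (ℕ.m+[n∸m]≡n (2≤f i)))
  where
  open Totals

  g : Fin r → ℕ
  g i = f i ∸ 2

  -- `h i` is the excess over 2 of the degree of a red point; in a tree with exactly the `b` blue
  -- points as leaves these excesses sum to `b - 2`.
  lowered : ∃[ h ] ((∀ i → h i ≤ g i) × total h ≡ b ∸ 2)
  lowered = lower-to g (b ∸ 2) (ℕ.m≤n+o⇒m∸n≤o b 2 (≡.subst (b ≤_) (ℕ.+-comm (total g) 2) b≤))

  h : Fin r → ℕ
  h = proj₁ lowered

  h≤g : ∀ i → h i ≤ g i
  h≤g = proj₁ (proj₂ lowered)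

  -- Degrees less one: `1 + h i` on red points and 0 on blue ones.
  ch : Fin (r + b) → ℕ
  ch = (suc ∘ h) ++ (λ _ → 0)

  open Configuration ℝ (R ++ B) general using (module Construction)
  open Construction ch using (spanning-tree)

  balance : sumᴸ (map ch (allFin (r + b))) + 2 ≡ r + b
  balance = begin
    sumᴸ (map ch (allFin (r + b))) + 2  ≡⟨ ≡.cong (_+ 2) (sum-allFin ch) ⟩
    total ch + 2                        ≡⟨ ≡.cong (_+ 2) (total-++ (suc ∘ h) (λ _ → 0)) ⟩
    total (suc ∘ h) + total {b} (λ _ → 0) + 2
      ≡⟨ ≡.cong₂ (λ s t → s + t + 2) (total-suc h) (total-zero b) ⟩
    r + total h + 0 + 2                 ≡⟨ ≡.cong (_+ 2) (ℕ.+-identityʳ (r + total h)) ⟩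
    r + total h + 2                     ≡⟨ ℕ.+-assoc r (total h) 2 ⟩
    r + (total h + 2)                   ≡⟨ ≡.cong (λ t → r + (t + 2)) (proj₂ (proj₂ lowered)) ⟩
    r + (b ∸ 2 + 2)                     ≡⟨ ≡.cong (r +_) (ℕ.m∸n+n≡m 2≤b) ⟩
    r + b                               ∎
    where open ≡.≡-Reasoning

  built : Σ[ G ∈ Graph (r + b) ] (Plane.IsNonCrossingSpanningTree ℝ (R ++ B) G ×
    (∀ v → Graph.degree G v ≡ suc (ch v)))
  built = let x , y , xs , all = two-first (ℕ.≤-trans 2≤b (ℕ.m≤n+m b r))
          in spanning-tree x y xs all balance

  G : Graph (r + b)
  G = proj₁ built

  open Graph G

  tree : Plane.IsNonCrossingSpanningTree ℝ (R ++ B) G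
  tree = proj₁ (proj₂ built)

  red : ∀ i → degree (i ↑ˡ b) ≡ 2 + h i
  red i = ≡.trans (proj₂ (proj₂ built) (i ↑ˡ b))
    (≡.cong (suc ∘ [ suc ∘ h , (λ _ → 0) ]′) (splitAt-↑ˡ r i b))

  blue : ∀ j → degree (r ↑ʳ j) ≡ 1
  blue j = ≡.trans (proj₂ (proj₂ built) (r ↑ʳ j))
    (≡.cong (suc ∘ [ suc ∘ h , (λ _ → 0) ]′) (splitAt-↑ʳ r b j))

  leaves : ∀ v → Leaf v ⇔ (∃[ j ] v ≡ r ↑ʳ j)
  leaves v = mk⇔ leaf⇒blue (λ { (j , ≡.refl) → blue j })
    where
    leaf⇒blue : Leaf v → ∃[ j ] v ≡ r ↑ʳ j
    leaf⇒blue leaf with splitAt r v in eq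
    ... | inj₂ j = j , ≡.sym (splitAt⁻¹-↑ʳ eq)
    -- A red point has degree `2 + h i`, which is never 1.
    ... | inj₁ i with ≡.trans (≡.sym (red i)) (≡.trans (≡.cong degree (splitAt⁻¹-↑ˡ eq)) leaf)
    ...   | ()

  bound : ∀ i {k} → k ≤ f i ∸ 2 → 2 + k ≤ f i
  bound i k≤ = ≡.subst (2 + _ ≤_) (ℕ.m+[n∸m]≡n (2≤f i)) (ℕ.+-monoʳ-≤ 2 k≤)

  -- In the case of equality the target `b ∸ 2` is all of `total g`, so nothing has been lowered.
  tight : b ≡ total g + 2 → ∀ i → h i ≡ g i
  tight b≡ = total-tight h≤g (≡.trans (proj₂ (proj₂ lowered))
    (≡.trans (≡.cong (_∸ 2) b≡) (ℕ.m+n∸n≡m (total g) 2)))
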